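{- Let $n\ge1$ and $\nu$ a permutation of $[n]$. Then: (1) $\mathrm{WZ}_\nu^{2n}(x)=x$ for all $x\in S_n$. (2) For $1\le j\le n$ let $f_j(x)=1$ if $j\in\{x_1,\dots,x_n\}$ and $0$ otherwise. Then $f_j$ is homomesic for $\mathrm{WZ}_\nu$ on $S_n$ with average $1/2$ along every orbit; hence any real linear combination of the $f_j$ is homomesic.
   Context: $S_n$ is the set of integer $n$-tuples $x=(x_1,\dots,x_n)$ such that for some $0\le k\le n$, $x_1=\dots=x_k=0$ and $1\le x_{k+1}<\dots<x_n\le n$. Winching with zeros on index $i$, $\mathrm{WZ}_i:S_n\to S_n$, changes only the $i$-th coordinate, to: $x_i+1$ if $x_i+1<x_{i+1}$ (where $x_{n+1}:=n+1$); otherwise $x_{i-1}+1$ if $i>1$ and $x_{i-1}>0$; otherwise $0$. $\mathrm{WZ}_\nu=\mathrm{WZ}_{\nu(n)}\circ\cdots\circ\mathrm{WZ}_{\nu(1)}$. A function on a finite set with a permutation $\tau$ is homomesic if its average over every $\tau$-orbit is the same constant. -}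

module Defs where

open import Data.Empty using (⊥-elim)
open import Data.Fin as Fin using (Fin; toℕ; inject₁) renaming (zero to fzero; suc to fsuc)
open import Data.Fin.Permutation using (Permutation′; _⟨$⟩ʳ_)
open import Data.Fin.Properties using (toℕ-inject₁; toℕ-injective; toℕ<n)
open import Data.Integer using (+_)
open import Data.List as List using (List; allFin; foldl; foldr)
open import Data.List.Membership.Propositional using (_∈_)
open import Data.List.NonEmpty as List⁺ using (List⁺)
open import Data.List.Relation.Unary.Unique.Propositional using (Unique)
open import Data.Nat as ℕ using (ℕ; zero; suc; z≤n; s≤s; s<s; _⊔_)
open import Data.Nat.GeneralisedArithmetic using (iterate)
open import Data.Nat.Properties as ℕₚ using ()
open import Data.Product using (∃-syntax; _×_; _,_)
open import Data.Rational as ℚ using (ℚ; 0ℚ; 1ℚ; ½; ∣_∣; Positive; positive)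
open import Data.Rational.Properties as ℚₚ using ()
open import Data.Rational.Solver using (module +-*-Solver)
open import Data.Sum using (_⊎_; inj₁; inj₂)
open import Data.Vec as Vec using (Vec; []; _∷_; lookup; _[_]≔_; _∷ʳ_)
open import Data.Vec.Membership.DecPropositional ℕ._≟_ using (_∈?_)
open import Data.Vec.Properties using (lookup∘updateAt; lookup∘updateAt′)
open import Function using (_⇔_)
open import Function.Definitions using (Bijective)
open import Relation.Binary.PropositionalEquality
open import Relation.Nullary using (yes; no)

-- Real numbers as Cauchy sequences of rationals; equality of reals is _≃_.
record ℝ : Set where
  constructor mkℝ
  field
    seq    : ℕ → ℚ
    cauchy : ∀ ε → 0ℚ ℚ.< ε → ∃[ N ] (∀ m n → N ℕ.≤ m → N ℕ.≤ n → ∣ seq m ℚ.- seq n ∣ ℚ.< ε)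

open ℝ public

infix  4 _≃_
infixl 6 _+ℝ_
infixl 7 _*ℝ_

_≃_ : ℝ → ℝ → Set
x ≃ y = ∀ ε → 0ℚ ℚ.< ε → ∃[ N ] (∀ n → N ℕ.≤ n → ∣ seq x n ℚ.- seq y n ∣ ℚ.< ε)

fromℚ : ℚ → ℝ
fromℚ q = mkℝ (λ _ → q) λ ε 0<ε → 0 , λ _ _ _ _ → subst (ℚ._< ε) (cong ∣_∣ (sym (ℚₚ.+-inverseʳ q))) 0<ε

private
  0<½* : ∀ {ε} → 0ℚ ℚ.< ε → 0ℚ ℚ.< ½ ℚ.* ε
  0<½* {ε} 0<ε = subst (ℚ._< ½ ℚ.* ε) (ℚₚ.*-zeroʳ ½) (ℚₚ.*-monoʳ-<-pos ½ 0<ε)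

  ½+½ : ∀ ε → ½ ℚ.* ε ℚ.+ ½ ℚ.* ε ≡ ε
  ½+½ ε = trans (sym (ℚₚ.*-distribʳ-+ ε ½ ½)) (ℚₚ.*-identityˡ ε)

  ∣+∣-< : ∀ {p q ε} → ∣ p ∣ ℚ.< ½ ℚ.* ε → ∣ q ∣ ℚ.< ½ ℚ.* ε → ∣ p ℚ.+ q ∣ ℚ.< ε
  ∣+∣-< {p} {q} {ε} a b =
    ℚₚ.≤-<-trans (ℚₚ.∣p+q∣≤∣p∣+∣q∣ p q) (subst (∣ p ∣ ℚ.+ ∣ q ∣ ℚ.<_) (½+½ ε) (ℚₚ.+-mono-< a b))

_+ℝ_ : ℝ → ℝ → ℝ
x +ℝ y = mkℝ (λ n → seq x n ℚ.+ seq y n) λ ε 0<ε →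
  let N₁ , p₁ = cauchy x (½ ℚ.* ε) (0<½* 0<ε)
      N₂ , p₂ = cauchy y (½ ℚ.* ε) (0<½* 0<ε)
  in N₁ ⊔ N₂ , λ m n N≤m N≤n →
    subst (λ z → ∣ z ∣ ℚ.< ε) (regroup (seq x m) (seq x n) (seq y m) (seq y n))
      (∣+∣-< {seq x m ℚ.- seq x n} {seq y m ℚ.- seq y n}
        (p₁ m n (ℕₚ.m⊔n≤o⇒m≤o N₁ N₂ N≤m) (ℕₚ.m⊔n≤o⇒m≤o N₁ N₂ N≤n))
        (p₂ m n (ℕₚ.m⊔n≤o⇒n≤o N₁ N₂ N≤m) (ℕₚ.m⊔n≤o⇒n≤o N₁ N₂ N≤n)))
  where
  regroup : ∀ a b c d → (a ℚ.- b) ℚ.+ (c ℚ.- d) ≡ (a ℚ.+ c) ℚ.- (b ℚ.+ d)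
  regroup = solve 4 (λ a b c d → (a :- b) :+ (c :- d) := (a :+ c) :- (b :+ d)) refl
    where open +-*-Solver

private
  bounded : ∀ x → ∃[ N ] ∃[ B ] 0ℚ ℚ.< B × (∀ n → N ℕ.≤ n → ∣ seq x n ∣ ℚ.< B)
  bounded x with cauchy x 1ℚ (ℚₚ.positive⁻¹ 1ℚ)
  ... | N , p = N , 1ℚ ℚ.+ ∣ seq x N ∣
      , ℚₚ.+-mono-<-≤ (ℚₚ.positive⁻¹ 1ℚ) (ℚₚ.0≤∣p∣ (seq x N))
      , λ n N≤n → ℚₚ.≤-<-trans
          (subst (λ z → ∣ z ∣ ℚ.≤ ∣ seq x n ℚ.- seq x N ∣ ℚ.+ ∣ seq x N ∣) (cancel (seq x n) (seq x N))
            (ℚₚ.∣p+q∣≤∣p∣+∣q∣ (seq x n ℚ.- seq x N) (seq x N)))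
          (ℚₚ.+-monoˡ-< ∣ seq x N ∣ (p n N N≤n ℕₚ.≤-refl))
    where
    cancel : ∀ a b → (a ℚ.- b) ℚ.+ b ≡ a
    cancel = solve 2 (λ a b → (a :- b) :+ b := a) refl
      where open +-*-Solver

  module _ (B ε : ℚ) (0<B : 0ℚ ℚ.< B) where
    private instance
      B-positive : Positive B
      B-positive = positive 0<B
      B-nonZero : ℚ.NonZero B
      B-nonZero = ℚₚ.pos⇒nonZero B
      1/B-positive : Positive (ℚ.1/ B)
      1/B-positive = ℚₚ.1/pos⇒pos B

    quotient : ℚ
    quotient = ℚ.1/ B ℚ.* ε

    0<quotient : 0ℚ ℚ.< ε → 0ℚ ℚ.< quotient
    0<quotient 0<ε = subst (ℚ._< quotient) (ℚₚ.*-zeroʳ (ℚ.1/ B)) (ℚₚ.*-monoʳ-<-pos (ℚ.1/ B) 0<ε)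

    ∣*∣-< : ∀ {p q} → ∣ p ∣ ℚ.< B → ∣ q ∣ ℚ.< quotient → ∣ p ℚ.* q ∣ ℚ.< ε
    ∣*∣-< {p} {q} p<B q<ε/B = begin-strict
      ∣ p ℚ.* q ∣        ≡⟨ ℚₚ.∣p*q∣≡∣p∣*∣q∣ p q ⟩
      ∣ p ∣ ℚ.* ∣ q ∣    ≤⟨ ℚₚ.*-monoʳ-≤-nonNeg ∣ q ∣ {{ℚ.nonNegative (ℚₚ.0≤∣p∣ q)}} (ℚₚ.<⇒≤ p<B) ⟩
      B ℚ.* ∣ q ∣        <⟨ ℚₚ.*-monoʳ-<-pos B q<ε/B ⟩
      B ℚ.* quotient     ≡⟨ ℚₚ.*-assoc B (ℚ.1/ B) ε ⟨
      B ℚ.* ℚ.1/ B ℚ.* ε ≡⟨ cong (ℚ._* ε) (ℚₚ.*-inverseʳ B) ⟩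
      1ℚ ℚ.* ε           ≡⟨ ℚₚ.*-identityˡ ε ⟩
      ε                  ∎
      where open ℚₚ.≤-Reasoning

_*ℝ_ : ℝ → ℝ → ℝ
x *ℝ y = mkℝ (λ n → seq x n ℚ.* seq y n) λ ε 0<ε →
  let M₁ , B₁ , 0<B₁ , b₁ = bounded x
      M₂ , B₂ , 0<B₂ , b₂ = bounded y
      N₁ , p₁ = cauchy x (quotient B₂ (½ ℚ.* ε) 0<B₂) (0<quotient B₂ (½ ℚ.* ε) 0<B₂ (0<½* 0<ε))
      N₂ , p₂ = cauchy y (quotient B₁ (½ ℚ.* ε) 0<B₁) (0<quotient B₁ (½ ℚ.* ε) 0<B₁ (0<½* 0<ε))
      l = ℕₚ.m⊔n≤o⇒m≤o
      r = ℕₚ.m⊔n≤o⇒n≤o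
  in (M₁ ⊔ M₂) ⊔ (N₁ ⊔ N₂) , λ m n N≤m N≤n →
    subst (λ z → ∣ z ∣ ℚ.< ε) (regroup (seq x m) (seq x n) (seq y m) (seq y n))
      (∣+∣-< {seq x m ℚ.* (seq y m ℚ.- seq y n)} {seq y n ℚ.* (seq x m ℚ.- seq x n)}
        (∣*∣-< B₁ (½ ℚ.* ε) 0<B₁ {seq x m} {seq y m ℚ.- seq y n}
          (b₁ m (l M₁ M₂ (l (M₁ ⊔ M₂) (N₁ ⊔ N₂) N≤m)))
          (p₂ m n (r N₁ N₂ (r (M₁ ⊔ M₂) (N₁ ⊔ N₂) N≤m)) (r N₁ N₂ (r (M₁ ⊔ M₂) (N₁ ⊔ N₂) N≤n))))
        (∣*∣-< B₂ (½ ℚ.* ε) 0<B₂ {seq y n} {seq x m ℚ.- seq x n}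
          (b₂ n (r M₁ M₂ (l (M₁ ⊔ M₂) (N₁ ⊔ N₂) N≤n)))
          (p₁ m n (l N₁ N₂ (r (M₁ ⊔ M₂) (N₁ ⊔ N₂) N≤m)) (l N₁ N₂ (r (M₁ ⊔ M₂) (N₁ ⊔ N₂) N≤n)))))
  where
  regroup : ∀ a b c d → a ℚ.* (c ℚ.- d) ℚ.+ d ℚ.* (a ℚ.- b) ≡ a ℚ.* c ℚ.- b ℚ.* d
  regroup = solve 4 (λ a b c d → a :* (c :- d) :+ d :* (a :- b) := a :* c :- b :* d) refl
    where open +-*-Solver

sumℝ : List ℝ → ℝ
sumℝ = foldr _+ℝ_ (fromℚ 0ℚ)

module _ {A : Set} where

  InOrbit : (A → A) → A → A → Set
  InOrbit τ x y = ∃[ k ] iterate τ x k ≡ y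

  Enumerates : List⁺ A → (A → Set) → Set
  Enumerates L P = Unique (List⁺.toList L) × (∀ y → y ∈ List⁺.toList L ⇔ P y)

  average : (A → ℝ) → List⁺ A → ℝ
  average f L = fromℚ (+ 1 ℚ./ List⁺.length L) *ℝ sumℝ (List.map f (List⁺.toList L))

  -- The average over a finite set does not depend on the repetition-free
  -- enumeration used to compute it, so one enumeration of each orbit suffices.
  -- For a permutation of a finite set, the forward orbit is the whole orbit.
  HomomesicWithAverage : (A → A) → (A → ℝ) → ℝ → Set
  HomomesicWithAverage τ f c =
    Bijective _≡_ _≡_ τ ×
    (∀ x → ∃[ L ] Enumerates L (InOrbit τ x) × average f L ≃ c)

  Homomesic : (A → A) → (A → ℝ) → Set
  Homomesic τ f = ∃[ c ] HomomesicWithAverage τ f c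

-- The coordinate x_i of the text is lookup x at the index
-- whose toℕ is i - 1, so "x_1, …, x_k" are the indices i with toℕ i < k.
record InS {n : ℕ} (x : Vec ℕ n) : Set where
  field
    k          : ℕ
    k≤n        : k ℕ.≤ n
    zeros      : ∀ i → toℕ i ℕ.< k → lookup x i ≡ 0
    positives  : ∀ i → k ℕ.≤ toℕ i → 1 ℕ.≤ lookup x i
    increasing : ∀ i j → k ℕ.≤ toℕ i → i Fin.< j → lookup x i ℕ.< lookup x j
    bounded-n  : ∀ i → k ℕ.≤ toℕ i → lookup x i ℕ.≤ n

-- Membership is irrelevant, so _≡_ on S n is equality of tuples.
record S (n : ℕ) : Set where
  constructor mkS
  field
    coords : Vec ℕ n
    .inS   : InS coords

open S public

-- x_{i+1}, where x_{n+1} = n + 1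
next : ∀ {n} → Vec ℕ n → Fin n → ℕ
next {n} x i = lookup (x ∷ʳ suc n) (fsuc i)

-- x_{i-1} + 1 if i > 1 and x_{i-1} > 0, and 0 otherwise
restart : ∀ {n} → Vec ℕ n → Fin n → ℕ
restart x fzero    = 0
restart x (fsuc i) with 0 ℕ.<? lookup x (inject₁ i)
... | yes _ = suc (lookup x (inject₁ i))
... | no  _ = 0

winched : ∀ {n} → Vec ℕ n → Fin n → ℕ
winched x i with suc (lookup x i) ℕ.<? next x i
... | yes _ = suc (lookup x i)
... | no  _ = restart x i

private
  record Local {n : ℕ} (x : Vec ℕ n) : Set where
    field
      incr  : ∀ a b → a Fin.< b → 0 ℕ.< lookup x a → lookup x a ℕ.< lookup x b
      upper : ∀ a → lookup x a ℕ.≤ n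

  toLocal : ∀ {n} {x : Vec ℕ n} → InS x → Local x
  toLocal {n} {x} p = record { incr = incr ; upper = upper }
    where
    open InS p
    incr : ∀ a b → a Fin.< b → 0 ℕ.< lookup x a → lookup x a ℕ.< lookup x b
    incr a b a<b 0<xa with toℕ a ℕ.<? k
    ... | yes a<k = ⊥-elim (ℕₚ.<-irrefl (sym (zeros a a<k)) 0<xa)
    ... | no  a≮k = increasing a b (ℕₚ.≮⇒≥ a≮k) a<b
    upper : ∀ a → lookup x a ℕ.≤ n
    upper a with toℕ a ℕ.<? k
    ... | yes a<k = subst (ℕ._≤ n) (sym (zeros a a<k)) z≤n
    ... | no  a≮k = bounded-n a (ℕₚ.≮⇒≥ a≮k)

  split : ∀ {n} (x : Vec ℕ n) → (∀ a b → a Fin.< b → 0 ℕ.< lookup x a → lookup x a ℕ.< lookup x b) →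
          ∃[ k ] k ℕ.≤ n × (∀ i → toℕ i ℕ.< k → lookup x i ≡ 0) × (∀ i → k ℕ.≤ toℕ i → 1 ℕ.≤ lookup x i)
  split []          _    = 0 , z≤n , (λ ()) , (λ ())
  split (suc a ∷ x) incr = 0 , z≤n , (λ _ ()) , pos
    where
    pos : ∀ i → 0 ℕ.≤ toℕ i → 1 ℕ.≤ lookup (suc a ∷ x) i
    pos fzero    _ = s≤s z≤n
    pos (fsuc i) _ = ℕₚ.<-trans (s≤s z≤n) (incr fzero (fsuc i) (s≤s z≤n) (s≤s z≤n))
  split (zero ∷ x)  incr with split x (λ a b a<b → incr (fsuc a) (fsuc b) (s<s a<b))
  ... | k , k≤n , zs , ps = suc k , s≤s k≤n , zs′ , ps′
    where
    zs′ : ∀ i → toℕ i ℕ.< suc k → lookup (zero ∷ x) i ≡ 0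
    zs′ fzero    _         = refl
    zs′ (fsuc i) (s≤s i<k) = zs i i<k
    ps′ : ∀ i → suc k ℕ.≤ toℕ i → 1 ℕ.≤ lookup (zero ∷ x) i
    ps′ (fsuc i) (s≤s k≤i) = ps i k≤i

  fromLocal : ∀ {n} {x : Vec ℕ n} → Local x → InS x
  fromLocal {x = x} p with split x (Local.incr p)
  ... | k , k≤n , zs , ps = record
    { k = k ; k≤n = k≤n ; zeros = zs ; positives = ps
    ; increasing = λ i j k≤i i<j → Local.incr p i j i<j (ps i k≤i)
    ; bounded-n = λ i _ → Local.upper p i
    }

  lookup-next : ∀ {n} (x : Vec ℕ n) d i →
                (suc (toℕ i) ≡ n × lookup (x ∷ʳ d) (fsuc i) ≡ d) ⊎
                (∃[ j ] toℕ j ≡ suc (toℕ i) × lookup (x ∷ʳ d) (fsuc i) ≡ lookup x j)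
  lookup-next (a ∷ [])    d fzero    = inj₁ (refl , refl)
  lookup-next (a ∷ b ∷ x) d fzero    = inj₂ (fsuc fzero , refl , refl)
  lookup-next (a ∷ x)     d (fsuc i) with lookup-next x d i
  ... | inj₁ (p , q)     = inj₁ (cong suc p , q)
  ... | inj₂ (j , p , q) = inj₂ (fsuc j , cong suc p , q)

  module _ {n} {x : Vec ℕ n} (p : Local x) where
    open Local p

    next≤ : ∀ i b → i Fin.< b → 0 ℕ.< next x i → next x i ℕ.≤ lookup x b
    next≤ i b i<b 0<next with lookup-next x (suc n) i
    ... | inj₁ (i+1≡n , _) = ⊥-elim (ℕₚ.<⇒≱ (toℕ<n b) (subst (ℕ._≤ toℕ b) i+1≡n i<b))
    ... | inj₂ (j , j≡ , e) rewrite e with ℕₚ.m≤n⇒m<n∨m≡n (subst (ℕ._≤ toℕ b) (sym j≡) i<b)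
    ...   | inj₁ j<b = ℕₚ.<⇒≤ (incr j b j<b 0<next)
    ...   | inj₂ j≡b = ℕₚ.≤-reflexive (cong (lookup x) (toℕ-injective j≡b))

    next≤1+n : ∀ i → next x i ℕ.≤ suc n
    next≤1+n i with lookup-next x (suc n) i
    ... | inj₁ (_ , e)     = ℕₚ.≤-reflexive e
    ... | inj₂ (j , _ , e) = subst (ℕ._≤ suc n) (sym e) (ℕₚ.m≤n⇒m≤1+n (upper j))

  restart≤ : ∀ {n} {x : Vec ℕ n} → Local x → ∀ i → restart x i ℕ.≤ lookup x i
  restart≤ p fzero = z≤n
  restart≤ {x = x} p (fsuc i) with 0 ℕ.<? lookup x (inject₁ i)
  ... | yes 0<x = Local.incr p (inject₁ i) (fsuc i) (s≤s (ℕₚ.≤-reflexive (toℕ-inject₁ i))) 0<x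
  ... | no  _   = z≤n

  <restart : ∀ {n} {x : Vec ℕ n} → Local x → ∀ a i → a Fin.< i → 0 ℕ.< lookup x a → lookup x a ℕ.< restart x i
  <restart {x = x} p a (fsuc i) (s≤s a≤i) 0<xa
    with 0 ℕ.<? lookup x (inject₁ i) | ℕₚ.m≤n⇒m<n∨m≡n (subst (toℕ a ℕ.≤_) (sym (toℕ-inject₁ i)) a≤i)
  ... | yes 0<x | inj₁ a<i = s≤s (ℕₚ.<⇒≤ (Local.incr p a (inject₁ i) a<i 0<xa))
  ... | yes 0<x | inj₂ a≡i = s≤s (ℕₚ.≤-reflexive (cong (lookup x) (toℕ-injective a≡i)))
  ... | no  0≮x | inj₁ a<i = ⊥-elim (0≮x (ℕₚ.<-trans 0<xa (Local.incr p a (inject₁ i) a<i 0<xa)))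
  ... | no  0≮x | inj₂ a≡i = ⊥-elim (0≮x (subst (λ z → 0 ℕ.< lookup x z) (toℕ-injective a≡i) 0<xa))

  module _ {n} {x : Vec ℕ n} (p : Local x) (i : Fin n) where
    open Local p

    winched< : ∀ b → i Fin.< b → 0 ℕ.< winched x i → winched x i ℕ.< lookup x b
    winched< b i<b 0<v with suc (lookup x i) ℕ.<? next x i
    ... | yes lt = ℕₚ.<-≤-trans lt (next≤ p i b i<b (ℕₚ.≤-<-trans z≤n lt))
    ... | no  _  = ℕₚ.≤-<-trans (restart≤ p i) (incr i b i<b (ℕₚ.<-≤-trans 0<v (restart≤ p i)))

    <winched : ∀ a → a Fin.< i → 0 ℕ.< lookup x a → lookup x a ℕ.< winched x i
    <winched a a<i 0<xa with suc (lookup x i) ℕ.<? next x i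
    ... | yes _ = ℕₚ.m<n⇒m<1+n (incr a i a<i 0<xa)
    ... | no  _ = <restart p a i a<i 0<xa

    winched≤n : winched x i ℕ.≤ n
    winched≤n with suc (lookup x i) ℕ.<? next x i
    ... | yes lt = ℕ.s≤s⁻¹ (ℕₚ.<-≤-trans lt (next≤1+n p i))
    ... | no  _  = ℕₚ.≤-trans (restart≤ p i) (upper i)

    winched-Local : Local (x [ i ]≔ winched x i)
    winched-Local = record { incr = incr′ ; upper = upper′ }
      where
      y : Vec ℕ n
      y = x [ i ]≔ winched x i
      at : lookup y i ≡ winched x i
      at = lookup∘updateAt i x
      off : ∀ {a} → a ≢ i → lookup y a ≡ lookup x a
      off {a} a≢i = lookup∘updateAt′ a i a≢i x
      incr′ : ∀ a b → a Fin.< b → 0 ℕ.< lookup y a → lookup y a ℕ.< lookup y b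
      incr′ a b a<b 0<ya with a Fin.≟ i | b Fin.≟ i
      ... | yes refl | yes refl = ⊥-elim (ℕₚ.<-irrefl refl a<b)
      ... | yes refl | no b≢i   = subst₂ ℕ._<_ (sym at) (sym (off b≢i)) (winched< b a<b (subst (0 ℕ.<_) at 0<ya))
      ... | no a≢i   | yes refl = subst₂ ℕ._<_ (sym (off a≢i)) (sym at) (<winched a a<b (subst (0 ℕ.<_) (off a≢i) 0<ya))
      ... | no a≢i   | no b≢i   = subst₂ ℕ._<_ (sym (off a≢i)) (sym (off b≢i)) (incr a b a<b (subst (0 ℕ.<_) (off a≢i) 0<ya))
      upper′ : ∀ a → lookup y a ℕ.≤ n
      upper′ a with a Fin.≟ i
      ... | yes refl = subst (ℕ._≤ n) (sym at) winched≤n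
      ... | no a≢i   = subst (ℕ._≤ n) (sym (off a≢i)) (upper a)

winched-InS : ∀ {n} {x : Vec ℕ n} i → InS x → InS (x [ i ]≔ winched x i)
winched-InS i p = fromLocal (winched-Local (toLocal p) i)

WZ : ∀ {n} → Fin n → S n → S n
WZ i (mkS x p) = mkS (x [ i ]≔ winched x i) (winched-InS i p)

-- foldl applies WZ at ν(1) first and WZ at ν(n) last.
WZ-perm : ∀ {n} → Permutation′ n → S n → S n
WZ-perm {n} ν x = foldl (λ y i → WZ (ν ⟨$⟩ʳ i) y) x (allFin n)

indicator : ∀ {n} → ℕ → S n → ℝ
indicator j x with j ∈? coords x
... | yes _ = fromℚ 1ℚ
... | no  _ = fromℚ 0ℚ

-- a_1 f_1 + … + a_n f_n, with a_j stored at the index whose toℕ is j - 1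
linearCombination : ∀ {n} → (Fin n → ℝ) → S n → ℝ
linearCombination {n} a x = sumℝ (List.map (λ j → a j *ℝ indicator (suc (toℕ j)) x) (allFin n))

{-# OPTIONS --safe #-}

-- Let x_i(t) be the i-th coordinate after t applications of WZ_ν, with x_0 = 0 and
-- x_{n+1} = n + 1.  Delaying column i by the number of k < i such that k + 1 is winched
-- before k gives an array y that evolves by winching from left to right.
--
-- Below or to the right of every entry 0 < v < n of y there is an entry v + 1, so the
-- positive entries decompose into snakes 1, 2, …, n ending in column n.  Along a snake
-- (time) + (column) - (value) is constant; hence the number of entries v on the
-- antidiagonal with label T does not depend on v, and it is 1 if y_n(T) = n and 0 otherwise.
-- On the other hand, column i is blocked at time t + 1 exactly if column i + 1 is blocked
-- at time t or a new snake starts at y_{i+1}(t+1) = 1.  Following this from column n to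
-- column 0, which is always blocked, shows that exactly one of y_n(t) = n and
-- y_n(t+n) = n holds.
--
-- This antiperiodicity gives the average 1/2 over any period, and since the columns are
-- determined, from right to left, by the times at which y_n = n, it gives the period 2n.
module Submission where

open import Defs
open import Data.Bool using (Bool; true; false; not; if_then_else_)
open import Data.Fin as Fin using (Fin; toℕ; fromℕ<; inject₁) renaming (zero to fzero; suc to fsuc)
open import Data.Fin.Permutation using (Permutation′; _⟨$⟩ʳ_; _⟨$⟩ˡ_; inverseˡ; inverseʳ)
open import Data.Fin.Properties using (toℕ-fromℕ<; toℕ-inject₁; toℕ-injective; toℕ<n)
open import Data.Integer as ℤ using ()
open import Data.Integer.Properties as ℤ using ()
open import Data.List as List using (List; []; _∷_; foldl; map; allFin; applyUpTo)
open import Data.List.Membership.Propositional using (_∈_)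
open import Data.List.Membership.Propositional.Properties using (∈-allFin; ∈-map⁺; ∈-applyUpTo⁺; ∈-applyUpTo⁻)
open import Data.List.NonEmpty as List⁺ using (List⁺; _∷_)
open import Data.List.Properties using (foldl-map; length-applyUpTo)
open import Data.List.Relation.Unary.All as All using (All; []; _∷_)
open import Data.List.Relation.Unary.AllPairs using (_∷_)
open import Data.List.Relation.Unary.Any using (here; there)
open import Data.List.Relation.Unary.Unique.Propositional using (Unique)
open import Data.List.Relation.Unary.Unique.Propositional.Properties using (allFin⁺; applyUpTo⁺₁) renaming (map⁺ to unique-map⁺)
open import Data.Nat using (ℕ; zero; suc; pred; _+_; _*_; _∸_; _≤_; _<_; z≤n; s≤s; s≤s⁻¹; _<?_; _≟_)
open import Data.Nat.DivMod using (_/_; _%_; m≡m%n+[m/n]*n; m%n<n)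
open import Data.Nat.GeneralisedArithmetic using (iterate)
open import Data.Nat.Properties
open import Data.Nat.Tactic.RingSolver using (solve-∀)
open import Data.Product using (_×_; _,_; proj₁; proj₂; ∃-syntax; map₂)
open import Data.Rational as ℚ using (ℚ; 0ℚ; 1ℚ; ½; ∣_∣; fromℚᵘ)
open import Data.Rational.Properties as ℚ using (toℚᵘ-injective; toℚᵘ-fromℚᵘ; toℚᵘ-homo-+; toℚᵘ-homo-*; fromℚᵘ-cong)
open import Data.Rational.Solver using (module +-*-Solver)
open import Data.Rational.Unnormalised as ℚᵘ using (mkℚᵘ; *≡*)
open import Data.Rational.Unnormalised.Properties as ℚᵘ using ()
open import Data.Sum using (_⊎_; inj₁; inj₂)
open import Data.Vec using (Vec; []; _∷_; lookup; _[_]≔_; _∷ʳ_)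
open import Data.Vec.Membership.DecPropositional _≟_ using (_∈?_)
open import Data.Vec.Membership.Propositional as Vec using ()
open import Data.Vec.Properties using (≡-dec)
open import Data.Vec.Relation.Unary.Any as Any using ()
open import Function using (_∘_; mk⇔)
open import Function.Definitions using (Injective; Bijective)
open import Relation.Binary.Definitions using (DecidableEquality)
open import Relation.Binary.PropositionalEquality using (_≡_; _≢_; refl; sym; trans; cong; cong₂; subst; ≢-sym; module ≡-Reasoning)
open import Relation.Nullary using (¬_; yes; no; contradiction)
open import Relation.Nullary.Decidable using (map′; recompute)
open import Relation.Unary using (Decidable)

-- Finite sums

∑ : ℕ → (ℕ → ℕ) → ℕ
∑ zero    f = 0
∑ (suc m) f = f 0 + ∑ m (f ∘ suc)

∑-cong : ∀ m {f g : ℕ → ℕ} → (∀ k → k < m → f k ≡ g k) → ∑ m f ≡ ∑ m g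
∑-cong zero    f≗g = refl
∑-cong (suc m) f≗g = cong₂ _+_ (f≗g 0 (s≤s z≤n)) (∑-cong m λ k k<m → f≗g (suc k) (s≤s k<m))

∑-const : ∀ m c → ∑ m (λ _ → c) ≡ m * c
∑-const zero    c = refl
∑-const (suc m) c = cong (c +_) (∑-const m c)

∑-zero : ∀ m {f : ℕ → ℕ} → (∀ k → k < m → f k ≡ 0) → ∑ m f ≡ 0
∑-zero m f≗0 = trans (∑-cong m f≗0) (trans (∑-const m 0) (*-zeroʳ m))

∑-+ : ∀ m (f g : ℕ → ℕ) → ∑ m (λ k → f k + g k) ≡ ∑ m f + ∑ m g
∑-+ zero    f g = refl
∑-+ (suc m) f g = trans (cong (f 0 + g 0 +_) (∑-+ m (f ∘ suc) (g ∘ suc))) (interchange (f 0) (g 0) _ _)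
  where
  interchange : ∀ a b c d → a + b + (c + d) ≡ a + c + (b + d)
  interchange = solve-∀

∑-swap : ∀ m p (f : ℕ → ℕ → ℕ) → ∑ m (λ k → ∑ p (f k)) ≡ ∑ p (λ t → ∑ m (λ k → f k t))
∑-swap zero    p f = sym (∑-zero p λ _ _ → refl)
∑-swap (suc m) p f = trans (cong (∑ p (f 0) +_) (∑-swap m p (f ∘ suc)))
  (sym (∑-+ p (f 0) λ t → ∑ m (λ k → f (suc k) t)))

∑-last : ∀ m (f : ℕ → ℕ) → (∀ k → k < m → f k ≡ 0) → ∑ (suc m) f ≡ f m
∑-last zero    f f≗0 = +-identityʳ (f 0)
∑-last (suc m) f f≗0 = trans (cong (_+ ∑ (suc m) (f ∘ suc)) (f≗0 0 (s≤s z≤n)))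
  (∑-last m (f ∘ suc) λ k k<m → f≗0 (suc k) (s≤s k<m))

-- The subtraction-free form of `f k - g k = r k - r (suc k)`. In the snake counts, `r` measures
-- what passes from one column to the next.
∑-telescope : ∀ m (f g r : ℕ → ℕ) → (∀ k → k < m → f k + r (suc k) ≡ g k + r k) → ∑ m f + r m ≡ ∑ m g + r 0
∑-telescope zero    f g r eq = refl
∑-telescope (suc m) f g r eq = begin
  f 0 + ∑ m (f ∘ suc) + r (suc m)   ≡⟨ +-assoc (f 0) _ _ ⟩
  f 0 + (∑ m (f ∘ suc) + r (suc m)) ≡⟨ cong (f 0 +_) (∑-telescope m (f ∘ suc) (g ∘ suc) (r ∘ suc) λ k k<m → eq (suc k) (s≤s k<m)) ⟩
  f 0 + (∑ m (g ∘ suc) + r 1)       ≡⟨ rotate (f 0) (∑ m (g ∘ suc)) (r 1) ⟩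
  f 0 + r 1 + ∑ m (g ∘ suc)         ≡⟨ cong (_+ ∑ m (g ∘ suc)) (eq 0 (s≤s z≤n)) ⟩
  g 0 + r 0 + ∑ m (g ∘ suc)         ≡⟨ rotate (g 0) (∑ m (g ∘ suc)) (r 0) ⟨
  g 0 + (∑ m (g ∘ suc) + r 0)       ≡⟨ +-assoc (g 0) _ _ ⟨
  g 0 + ∑ m (g ∘ suc) + r 0         ∎
  where
  open ≡-Reasoning
  rotate : ∀ a b c → a + (b + c) ≡ a + c + b
  rotate = solve-∀

Periodic : {A : Set} → ℕ → (ℕ → A) → Set
Periodic p f = ∀ t → f (t + p) ≡ f t

-- Moving the window by one step trades its first term `g 0` for `g p`, and periodicity makes these
-- equal.
∑-shift : ∀ {p} {f : ℕ → ℕ} → Periodic p f → ∀ s → ∑ p (λ t → f (t + s)) ≡ ∑ p f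
∑-shift {p} {f} per zero    = ∑-cong p λ t _ → cong f (+-identityʳ t)
∑-shift {p} {f} per (suc s) = trans shift₁ (∑-shift per s)
  where
  g : ℕ → ℕ
  g t = f (t + s)

  g-period : g p ≡ g 0
  g-period = trans (cong f (+-comm p s)) (per s)

  shift₁ : ∑ p (λ t → f (t + suc s)) ≡ ∑ p g
  shift₁ = trans (∑-cong p λ t _ → cong f (+-suc t s))
    (sym (+-cancelʳ-≡ (g 0) _ _ (trans (cong (∑ p g +_) (sym g-period))
      (∑-telescope p g (g ∘ suc) g λ k _ → +-comm (g k) (g (suc k))))))

δ : ℕ → ℕ → ℕ
δ zero    zero    = 1
δ zero    (suc _) = 0
δ (suc _) zero    = 0
δ (suc a) (suc b) = δ a b

δ-refl : ∀ a → δ a a ≡ 1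
δ-refl zero    = refl
δ-refl (suc a) = δ-refl a

δ-≢ : ∀ {a b} → a ≢ b → δ a b ≡ 0
δ-≢ {zero}  {zero}  a≢b = contradiction refl a≢b
δ-≢ {zero}  {suc b} a≢b = refl
δ-≢ {suc a} {zero}  a≢b = refl
δ-≢ {suc a} {suc b} a≢b = δ-≢ (a≢b ∘ cong suc)

-- Winching one entry between its two neighbours

-- With x_0 = 0 as left neighbour this also covers the first coordinate, so it agrees with `restart`
-- at every index.
reset : ℕ → ℕ
reset zero    = 0
reset (suc a) = suc (suc a)

winch : ℕ → ℕ → ℕ → ℕ
winch a b d with suc b <? d
... | yes _ = suc b
... | no  _ = reset a

-- The shape "zeros, then strictly increasing positive entries", expressed on neighbours alone.
_◁_ : ℕ → ℕ → Set
a ◁ b = 0 < a → a < b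

data WinchView (a b d : ℕ) : ℕ → Set where
  free  : suc b < d → WinchView a b d (suc b)
  stuck : d ≤ suc b → WinchView a b d (reset a)

winchView : ∀ a b d → WinchView a b d (winch a b d)
winchView a b d with suc b <? d
... | yes b+1<d = free b+1<d
... | no  b+1≮d = stuck (≮⇒≥ b+1≮d)

-- Is 1 if `d ≤ suc b`, so that `b` cannot be raised below `d`, and 0 otherwise. Being a number, it
-- can enter sums.
blocked : ℕ → ℕ → ℕ
blocked b       zero          = 1
blocked zero    (suc zero)    = 1
blocked zero    (suc (suc d)) = 0
blocked (suc b) (suc d)       = blocked b d

blocked-free : ∀ {b d} → suc b < d → blocked b d ≡ 0
blocked-free {zero}  {suc zero}    (s≤s ())
blocked-free {zero}  {suc (suc d)} _         = refl
blocked-free {suc b} {suc d}       (s≤s b<d) = blocked-free b<d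

blocked-stuck : ∀ {b d} → d ≤ suc b → blocked b d ≡ 1
blocked-stuck {b}     {zero}     _         = refl
blocked-stuck {zero}  {suc zero} _         = refl
blocked-stuck {zero}  {suc (suc d)} (s≤s ())
blocked-stuck {suc b} {suc d}    (s≤s d≤b) = blocked-stuck d≤b

blocked-suc : ∀ {b n} → b ≤ n → blocked b (suc n) ≡ δ b n
blocked-suc {zero}  {zero}  _         = refl
blocked-suc {zero}  {suc n} _         = refl
blocked-suc {suc b} {suc n} (s≤s b≤n) = blocked-suc b≤n

-- A blocked entry is determined by its right neighbour. Injectivity and the recovery of columns
-- both rest on this.
stuck-value : ∀ {b d} → b ◁ d → d ≤ suc b → b ≡ pred d
stuck-value {zero}  {zero}     _   _         = refl
stuck-value {zero}  {suc zero} _   _         = refl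
stuck-value {zero}  {suc (suc d)} _ (s≤s ())
stuck-value {suc b} {d}        b◁d d≤        = cong pred (≤-antisym (b◁d (s≤s z≤n)) d≤)

◁-winch : ∀ {a b} d → a ◁ b → a ◁ winch a b d
◁-winch {a} {b} d a◁b 0<a with winch a b d | winchView a b d
... | _ | free _ = m<n⇒m<1+n (a◁b 0<a)
◁-winch {suc a} d a◁b 0<a | _ | stuck _ = ≤-refl

winch-◁ : ∀ {a b d} → a ◁ b → b ◁ d → winch a b d ◁ d
winch-◁ {a} {b} {d} a◁b b◁d 0<w with winch a b d | winchView a b d
... | _ | free b+1<d = b+1<d
winch-◁ {suc a} {b} {d} a◁b b◁d 0<w | _ | stuck _ =
  ≤-<-trans (a◁b (s≤s z≤n)) (b◁d (<-trans (s≤s z≤n) (a◁b (s≤s z≤n))))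

-- A raised entry exceeds `reset a`, so the result reveals which rule was applied; then `b` is the
-- predecessor of the result or of `d`.
winch-injective : ∀ {a b b′ d} → a ◁ b → b ◁ d → a ◁ b′ → b′ ◁ d → winch a b d ≡ winch a b′ d → b ≡ b′
winch-injective {a} {b} {b′} {d} a◁b b◁d a◁b′ b′◁d eq
  with winch a b d | winch a b′ d | winchView a b d | winchView a b′ d
... | _ | _ | free _  | free _   = suc-injective eq
... | _ | _ | stuck p | stuck p′ = trans (stuck-value b◁d p) (sym (stuck-value b′◁d p′))
winch-injective {suc a} a◁b _ _ _ eq | _ | _ | free _ | stuck _ =
  contradiction (sym (suc-injective eq)) (<⇒≢ (a◁b (s≤s z≤n)))
winch-injective {suc a} _ _ a◁b′ _ eq | _ | _ | stuck _ | free _ =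
  contradiction (suc-injective eq) (<⇒≢ (a◁b′ (s≤s z≤n)))

-- A reset places `suc a`, or 0 if `a` is 0, next to `a` and so blocks it. A raise blocks `a` only
-- if it turns 0 into 1. As `reset` never yields 1, the two cases exclude each other.
blocked-winch : ∀ {a b d} → a ◁ b → blocked a (winch a b d) ≡ blocked b d + δ (winch a b d) 1
blocked-winch {a} {b} {d} a◁b with winch a b d | winchView a b d
blocked-winch {zero}  {zero}  a◁b | _ | free lt = cong (_+ 1) (sym (blocked-free lt))
blocked-winch {suc a} {zero}  a◁b | _ | free lt = contradiction (a◁b (s≤s z≤n)) λ ()
blocked-winch {zero}  {suc b} a◁b | _ | free lt = cong (_+ 0) (sym (blocked-free lt))
blocked-winch {suc a} {suc b} {d} a◁b | _ | free lt =
  trans (blocked-free (s≤s (a◁b (s≤s z≤n)))) (cong (_+ 0) (sym (blocked-free lt)))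
blocked-winch {zero}  a◁b | _ | stuck ge = cong (_+ 0) (sym (blocked-stuck ge))
blocked-winch {suc a} a◁b | _ | stuck ge =
  trans (blocked-stuck {suc a} {suc (suc a)} ≤-refl) (cong (_+ 0) (sym (blocked-stuck ge)))

-- An entry v that is free is followed by v + 1 in the same column, one that is
-- blocked by v + 1 in the column to its right.
snake-step : ∀ {a b d} v → a ◁ b → b ◁ d →
  δ (winch a b d) (2 + v) + δ b (suc v) * blocked b d ≡ δ b (suc v) + δ a (suc v) * blocked a (winch a b d)
snake-step {a} {b} {d} v a◁b b◁d with winch a b d | winchView a b d
... | _ | free lt rewrite blocked-free lt | *-zeroʳ (δ b (suc v)) = cong (δ b (suc v) +_) (sym (right a a◁b))
  where
  right : ∀ a → a ◁ b → δ a (suc v) * blocked a (suc b) ≡ 0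
  right zero    _   = refl
  right (suc a) a◁b rewrite blocked-free {suc a} (s≤s (a◁b (s≤s z≤n))) = *-zeroʳ (δ a v)
snake-step {zero}  {b} v a◁b b◁d | _ | stuck ge rewrite blocked-stuck ge =
  trans (*-identityʳ _) (sym (+-identityʳ _))
snake-step {suc a} {b} v a◁b b◁d | _ | stuck ge rewrite blocked-stuck ge | blocked-stuck {suc a} {2 + a} ≤-refl =
  trans (+-comm (δ a v) _) (cong₂ _+_ (*-identityʳ (δ b (suc v))) (sym (*-identityʳ (δ a v))))

-- Row t + 1 arises from row t by winching the columns 1, …, n from left to right;
-- the first argument of y is the column.

record Evolution (n : ℕ) (y : ℕ → ℕ → ℕ) : Set where
  field
    left    : ∀ t → y 0 t ≡ 0
    right   : ∀ t → y (suc n) t ≡ suc n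
    rises   : ∀ {i} t → i ≤ n → y i t ◁ y (suc i) t
    evolves : ∀ {i} t → i < n → y (suc i) (suc t) ≡ winch (y i (suc t)) (y (suc i) t) (y (2 + i) t)

  -- This is the state in the middle of a left-to-right sweep: column `i` is new, column `suc i`
  -- still old. Each column supplies the hypothesis of `winch-◁` for the next.
  rises-diagonally : ∀ i t → i ≤ n → y i (suc t) ◁ y (suc i) t
  rises-diagonally zero    t _   0<y = contradiction (sym (left (suc t))) (<⇒≢ 0<y)
  rises-diagonally (suc i) t i<n = subst (_◁ y (2 + i) t) (sym (evolves t i<n))
    (winch-◁ (rises-diagonally i t (<⇒≤ i<n)) (rises t i<n))

  -- The boundary entry `suc n` caps column n, and the cap drops by one with each column to the
  -- left.
  ≤-column : ∀ k {i} t → k + i ≡ n → y i t ≤ i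
  ≤-column zero {i} t refl with y i t | rises {i} t ≤-refl
  ... | zero  | _ = z≤n
  ... | suc b | r = s≤s⁻¹ (subst (suc b <_) (right t) (r (s≤s z≤n)))
  ≤-column (suc k) {i} t eq with y i t | rises {i} t (subst (i ≤_) eq (m≤n+m i (suc k))) | ≤-column k {suc i} t (trans (+-suc k i) eq)
  ... | zero  | _ | _  = z≤n
  ... | suc b | r | ih = s≤s⁻¹ (<-≤-trans (r (s≤s z≤n)) ih)

  bound : ∀ {i} t → i ≤ n → y i t ≤ i
  bound {i} t i≤n = ≤-column (n ∸ i) t (m∸n+n≡m i≤n)

shift-evolution : ∀ {n y} s → Evolution n y → Evolution n (λ i t → y i (t + s))
shift-evolution s ev = record
  { left    = λ t → left (t + s)
  ; right   = λ t → right (t + s)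
  ; rises   = λ t → rises (t + s)
  ; evolves = λ t → evolves (t + s)
  } where open Evolution ev

-- Counting along snakes, and antiperiodicity of the top value

module _ {n y} (ev : Evolution n y) where
  open Evolution ev

  blockedAt : ℕ → ℕ → ℕ
  blockedAt i t = blocked (y i t) (y (suc i) t)

  blockedAt-suc : ∀ {i} t → i < n → blockedAt i (suc t) ≡ blockedAt (suc i) t + δ (y (suc i) (suc t)) 1
  blockedAt-suc {i} t i<n rewrite evolves t i<n = blocked-winch {d = y (2 + i) t} (rises-diagonally i t (<⇒≤ i<n))

  blockedAt-last : ∀ t → blockedAt n t ≡ δ (y n t) n
  blockedAt-last t rewrite right t = blocked-suc (bound t ≤-refl)

  blockedAt-first : ∀ t → blockedAt 0 t ≡ 1
  blockedAt-first t rewrite left t = blocked-stuck (first n refl)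
    where
    first : ∀ m → n ≡ m → y 1 t ≤ 1
    first zero    refl = ≤-reflexive (right t)
    first (suc m) refl = bound t (s≤s z≤n)

  -- The cells of value v that lie on the snake reaching the value n in column n at time t + n.
  onSnake : ℕ → ℕ → ℕ
  onSnake v t = ∑ n (λ k → δ (y (suc k) (n ∸ suc k + v + t)) v)

  -- No snake enters from column 0, which is 0, and none leaves column n before the value n, the
  -- only value blocked there.
  onSnake-suc : ∀ v t → suc v < n → onSnake (2 + v) t ≡ onSnake (suc v) t
  onSnake-suc v t v<n = begin
    onSnake (2 + v) t       ≡⟨ +-identityʳ _ ⟨
    onSnake (2 + v) t + 0   ≡⟨ cong (onSnake (2 + v) t +_) r-last ⟨
    onSnake (2 + v) t + r n ≡⟨ ∑-telescope n _ _ r step ⟩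
    onSnake (suc v) t + r 0 ≡⟨ cong (onSnake (suc v) t +_) r-first ⟩
    onSnake (suc v) t + 0   ≡⟨ +-identityʳ _ ⟩
    onSnake (suc v) t       ∎
    where
    open ≡-Reasoning

    -- `r k` is 1 if a snake crosses from column `k` to column `suc k` between the values `suc v`
    -- and `2 + v`.
    r : ℕ → ℕ
    r k = δ (y k (n ∸ k + suc v + t)) (suc v) * blockedAt k (n ∸ k + suc v + t)

    r-first : r 0 ≡ 0
    r-first rewrite left (n + suc v + t) = refl

    r-last : r n ≡ 0
    r-last = trans (cong (δ (y n s) (suc v) *_) (blockedAt-last s)) (vanish (y n s))
      where
      s = n ∸ n + suc v + t
      vanish : ∀ b → δ b (suc v) * δ b n ≡ 0
      vanish b with b ≟ n
      ... | yes refl = cong (_* δ b b) (δ-≢ (≢-sym (<⇒≢ v<n)))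
      ... | no  b≢n  = trans (cong (δ b (suc v) *_) (δ-≢ b≢n)) (*-zeroʳ (δ b (suc v)))

    step : ∀ k → k < n → δ (y (suc k) (n ∸ suc k + (2 + v) + t)) (2 + v) + r (suc k)
                       ≡ δ (y (suc k) (n ∸ suc k + suc v + t)) (suc v) + r k
    -- As `n ∸ k` is `suc (n ∸ suc k)`, column `k` is read one time step later than column `suc k`,
    -- as `snake-step` requires.
    step k k<n rewrite +-∸-assoc 1 k<n | +-suc (n ∸ suc k) (suc v) | evolves (n ∸ suc k + suc v + t) k<n =
      snake-step v (rises-diagonally k _ (<⇒≤ k<n)) (rises _ k<n)

  -- Summing `blockedAt-suc` along the antidiagonal traces the permanent block of column 0 back
  -- either to column n at time `t` or to a single entry 1 on the way.
  onSnake-1 : ∀ t → onSnake 1 t + δ (y n t) n ≡ 1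
  onSnake-1 t = begin
    onSnake 1 t + δ (y n t) n       ≡⟨ cong (onSnake 1 t +_) (blockedAt-last t) ⟨
    onSnake 1 t + blockedAt n t     ≡⟨ cong (λ k → onSnake 1 t + blockedAt n (k + t)) (n∸n≡0 n) ⟨
    onSnake 1 t + r n               ≡⟨ ∑-telescope n _ (λ _ → 0) r step ⟩
    ∑ n (λ _ → 0) + r 0             ≡⟨ cong (_+ r 0) (∑-zero n λ _ _ → refl) ⟩
    blockedAt 0 (n + t)             ≡⟨ blockedAt-first (n + t) ⟩
    1                               ∎
    where
    open ≡-Reasoning

    r : ℕ → ℕ
    r k = blockedAt k (n ∸ k + t)

    step : ∀ k → k < n → δ (y (suc k) (n ∸ suc k + 1 + t)) 1 + r (suc k) ≡ r k
    step k k<n rewrite +-∸-assoc 1 k<n | +-comm (n ∸ suc k) 1 =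
      trans (+-comm _ (r (suc k))) (sym (blockedAt-suc _ k<n))

-- By `bound`, only the last column can hold the value `suc m`.
onSnake-last : ∀ {m y} (ev : Evolution (suc m) y) t → onSnake ev (suc m) t ≡ δ (y (suc m) (t + suc m)) (suc m)
onSnake-last {m} {y} ev t = trans
  (∑-last m (λ k → δ (y (suc k) (m ∸ k + suc m + t)) (suc m)) λ k k<m → δ-≢ (<⇒≢ (≤-<-trans (bound (m ∸ k + suc m + t) (s≤s (<⇒≤ k<m))) (s≤s k<m))))
  (cong (λ s → δ (y (suc m) s) (suc m)) (trans (cong (λ k → k + suc m + t) (n∸n≡0 m)) (+-comm (suc m) t)))
  where open Evolution ev

module _ {m y} (ev : Evolution (suc m) y) where
  open Evolution ev

  private
    n = suc m

  atTop : ℕ → ℕ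
  atTop t = δ (y n t) n

  onSnake≡atTop : ∀ k {v} t → k + suc v ≡ n → onSnake ev (suc v) t ≡ atTop (t + n)
  onSnake≡atTop zero    t refl = onSnake-last ev t
  onSnake≡atTop (suc k) {v} t eq = trans
    (sym (onSnake-suc ev v t (subst (suc (suc v) ≤_) eq (s≤s (m≤n+m (suc v) k)))))
    (onSnake≡atTop k t (trans (+-suc k (suc v)) eq))

  -- The snake count is the same at value 1, where `onSnake-1` evaluates it, and at value n, where
  -- it is `atTop (t + n)`.
  atTop-antiperiodic : ∀ t → atTop (t + n) + atTop t ≡ 1
  atTop-antiperiodic t = trans (cong (_+ atTop t) (sym (onSnake≡atTop m t (+-comm m 1)))) (onSnake-1 ev t)

  atTop-periodic : Periodic (n + n) atTop
  atTop-periodic t = +-cancelʳ-≡ (atTop (t + n)) _ _ (begin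
    atTop (t + (n + n)) + atTop (t + n) ≡⟨ cong (λ s → atTop s + atTop (t + n)) (+-assoc t n n) ⟨
    atTop (t + n + n) + atTop (t + n)   ≡⟨ atTop-antiperiodic (t + n) ⟩
    1                                   ≡⟨ atTop-antiperiodic t ⟨
    atTop (t + n) + atTop t             ≡⟨ +-comm (atTop (t + n)) _ ⟩
    atTop t + atTop (t + n)             ∎)
    where open ≡-Reasoning

  -- Over a full period each column may be shifted onto the snake diagonals, so every `j` occurs as
  -- often as the top value; antiperiodicity then pairs the times. Any period is allowed, since
  -- orbit lengths are to be inserted for `p`.
  occurrences : ∀ {p j} → (∀ {i} → i ≤ n → Periodic p (y i)) → 1 ≤ j → j ≤ n →
    ∑ p (λ t → ∑ n (λ k → δ (y (suc k) t) j)) + ∑ p (λ t → ∑ n (λ k → δ (y (suc k) t) j)) ≡ p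
  occurrences {p} {suc v} per 1≤j j≤n = begin
    total + total                                  ≡⟨ cong₂ _+_ total≡ total≡ ⟩
    ∑ p atTop + ∑ p atTop                          ≡⟨ cong (_+ ∑ p atTop) (∑-shift (λ t → cong (λ b → δ b n) (per ≤-refl t)) n) ⟨
    ∑ p (λ t → atTop (t + n)) + ∑ p atTop          ≡⟨ ∑-+ p (λ t → atTop (t + n)) atTop ⟨
    ∑ p (λ t → atTop (t + n) + atTop t)            ≡⟨ ∑-cong p (λ t _ → atTop-antiperiodic t) ⟩
    ∑ p (λ _ → 1)                                  ≡⟨ ∑-const p 1 ⟩
    p * 1                                          ≡⟨ *-identityʳ p ⟩
    p                                              ∎
    where
    open ≡-Reasoning
    j = suc v
    total = ∑ p (λ t → ∑ n (λ k → δ (y (suc k) t) j))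

    shift-column : ∀ k → k < n → ∑ p (λ t → δ (y (suc k) t) j) ≡ ∑ p (λ t → δ (y (suc k) (n ∸ suc k + j + t)) j)
    shift-column k k<n = trans
      (sym (∑-shift (λ t → cong (λ b → δ b j) (per k<n t)) (n ∸ suc k + j)))
      (∑-cong p λ t _ → cong (λ s → δ (y (suc k) s) j) (+-comm t _))

    total≡ : total ≡ ∑ p atTop
    total≡ = begin
      total                                                     ≡⟨ ∑-swap p n (λ t k → δ (y (suc k) t) j) ⟩
      ∑ n (λ k → ∑ p (λ t → δ (y (suc k) t) j))                 ≡⟨ ∑-cong n shift-column ⟩
      ∑ n (λ k → ∑ p (λ t → δ (y (suc k) (n ∸ suc k + j + t)) j)) ≡⟨ ∑-swap n p (λ k t → δ (y (suc k) (n ∸ suc k + j + t)) j) ⟩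
      ∑ p (onSnake ev j)                                        ≡⟨ ∑-cong p (λ t _ → onSnake≡atTop (n ∸ j) t (m∸n+n≡m j≤n)) ⟩
      ∑ p (λ t → atTop (t + n))                                 ≡⟨ ∑-shift (λ t → cong (λ b → δ b n) (per ≤-refl t)) n ⟩
      ∑ p atTop                                                 ∎

-- Recovering the columns from the top values, and the period 2n

module _ {n y y′} (ev : Evolution n y) (ev′ : Evolution n y′) where
  private
    module Y  = Evolution ev
    module Y′ = Evolution ev′

  -- At a blocked time `stuck-value` computes the column from its right neighbour; at a free time
  -- the value is one less than the next one.
  column-agrees : ∀ {i} s → i < n →
    (∀ t → s ≤ t → y (2 + i) t ≡ y′ (2 + i) t) →
    (∀ t → s ≤ t → blockedAt ev (suc i) t ≡ blockedAt ev′ (suc i) t) →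
    ∀ t → s ≤ t → y (suc i) t ≡ y′ (suc i) t
  column-agrees {i} s i<n right-agrees blocked-agrees t s≤t = go (suc n) t s≤t (s≤s (m≤m+n n _))
    where
    next-row : ∀ {z} → Evolution n z → ∀ t {b} → winch (z i (suc t)) (z (suc i) t) (z (2 + i) t) ≡ b → z (suc i) (suc t) ≡ b
    next-row ev t eq = trans (Evolution.evolves ev t i<n) eq

    -- Before it is blocked a column increases, so its values are read off backwards from that event.
    go : ∀ fuel t → s ≤ t → n < fuel + y (suc i) t → y (suc i) t ≡ y′ (suc i) t
    -- Each unit of fuel spent raises the entry by one, so running out would put it above n.
    go zero t s≤t n<y = contradiction (≤-trans (Y.bound t i<n) i<n) (<⇒≱ n<y)
    go (suc fuel) t s≤t n<y
      with winch (y i (suc t)) (y (suc i) t) (y (2 + i) t) in eq | winchView (y i (suc t)) (y (suc i) t) (y (2 + i) t)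
         | winch (y′ i (suc t)) (y′ (suc i) t) (y′ (2 + i) t) in eq′ | winchView (y′ i (suc t)) (y′ (suc i) t) (y′ (2 + i) t)
    ... | _ | free lt  | _ | free lt′  = suc-injective (begin
      suc (y (suc i) t)   ≡⟨ next-row ev t eq ⟨
      y (suc i) (suc t)   ≡⟨ go fuel (suc t) (m≤n⇒m≤1+n s≤t) fuel-suffices ⟩
      y′ (suc i) (suc t)  ≡⟨ next-row ev′ t eq′ ⟩
      suc (y′ (suc i) t)  ∎)
      where
      open ≡-Reasoning
      fuel-suffices : n < fuel + y (suc i) (suc t)
      fuel-suffices = subst (n <_) (trans (sym (+-suc fuel _)) (cong (fuel +_) (sym (next-row ev t eq)))) n<y
    ... | _ | stuck ge | _ | stuck ge′ = trans (stuck-value (Y.rises t i<n) ge)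
      (trans (cong pred (right-agrees t s≤t)) (sym (stuck-value (Y′.rises t i<n) ge′)))
    ... | _ | free lt  | _ | stuck ge′ = contradiction
      (trans (sym (blocked-free lt)) (trans (blocked-agrees t s≤t) (blocked-stuck ge′))) λ ()
    ... | _ | stuck ge | _ | free lt′  = contradiction
      (trans (sym (blocked-free lt′)) (trans (sym (blocked-agrees t s≤t)) (blocked-stuck ge))) λ ()

  -- Induction on the distance `k` from column n. By `blockedAt-suc`, the blocks of a column at
  -- `suc t` depend on the next column at `t` and `suc t`, so every column further left costs one
  -- time step.
  agree : (∀ t → δ (y n t) n ≡ δ (y′ n t) n) → ∀ k {i} → k + suc i ≡ n → ∀ t → k ≤ t →
    y (suc i) t ≡ y′ (suc i) t × blockedAt ev (suc i) t ≡ blockedAt ev′ (suc i) t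
  agree top zero refl t _ =
    column-agrees 0 ≤-refl (λ t _ → trans (Y.right t) (sym (Y′.right t))) (λ t _ → blocked-agrees t) t z≤n , blocked-agrees t
    where
    blocked-agrees : ∀ t → blockedAt ev n t ≡ blockedAt ev′ n t
    blocked-agrees t = trans (blockedAt-last ev t) (trans (top t) (sym (blockedAt-last ev′ t)))
  agree top (suc k) {i} eq t k<t =
    column-agrees (suc k) (<⇒≤ i+1<n) (λ t k<t → proj₁ (ih t (<⇒≤ k<t))) blocked-agrees t k<t , blocked-agrees t k<t
    where
    ih : ∀ t → k ≤ t → y (2 + i) t ≡ y′ (2 + i) t × blockedAt ev (2 + i) t ≡ blockedAt ev′ (2 + i) t
    ih = agree top k (trans (+-suc k (suc i)) eq)

    i+1<n : suc i < n
    i+1<n = subst (2 + i ≤_) eq (s≤s (m≤n+m (suc i) k))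

    blocked-agrees : ∀ t → suc k ≤ t → blockedAt ev (suc i) t ≡ blockedAt ev′ (suc i) t
    blocked-agrees (suc t) (s≤s k≤t) = trans (blockedAt-suc ev t i+1<n)
      (trans (cong₂ _+_ (proj₂ (ih t k≤t)) (cong (λ b → δ b 1) (proj₁ (ih (suc t) (m≤n⇒m≤1+n k≤t)))))
        (sym (blockedAt-suc ev′ t i+1<n)))

-- The array shifted by 2n is an evolution with the same top values, so `agree` identifies the two
-- at late times. Early times are settled afterwards by injectivity.
evolution-periodic : ∀ {m y} → Evolution (suc m) y → ∀ {i t} → i ≤ m → suc m ≤ t →
  y (suc i) (t + (suc m + suc m)) ≡ y (suc i) t
evolution-periodic {m} ev {i} {t} i≤m n≤t = proj₁ (agree (shift-evolution _ ev) ev (atTop-periodic ev)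
  (m ∸ i) (trans (+-suc _ i) (cong suc (m∸n+n≡m i≤m))) t (≤-trans (m∸n≤m m i) (<⇒≤ n≤t)))

-- Iterates and orbits

iterate-suc : {A : Set} (f : A → A) (x : A) → ∀ t → iterate f x (suc t) ≡ f (iterate f x t)
iterate-suc f x zero    = refl
iterate-suc f x (suc t) = iterate-suc f (f x) t

iterate-+ : {A : Set} (f : A → A) (x : A) → ∀ s t → iterate f x (s + t) ≡ iterate f (iterate f x s) t
iterate-+ f x zero    t = refl
iterate-+ f x (suc s) t = iterate-+ f (f x) s t

iterate-injective : {A : Set} {f : A → A} → Injective _≡_ _≡_ f → ∀ t {x y} → iterate f x t ≡ iterate f y t → x ≡ y
iterate-injective inj zero    eq = eq
iterate-injective inj (suc t) eq = inj (iterate-injective inj t eq)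

periodic-multiple : ∀ {A : Set} {p} {f : ℕ → A} → Periodic p f → ∀ k t → f (t + k * p) ≡ f t
periodic-multiple {f = f} per zero    t = cong f (+-identityʳ t)
periodic-multiple {p = p} {f} per (suc k) t =
  trans (cong f (sym (+-assoc t p (k * p)))) (trans (periodic-multiple per k (t + p)) (per t))

least : ∀ {P : ℕ → Set} → Decidable P → ∀ k → P k → ∃[ q ] P q × (∀ j → j < q → ¬ P j)
least P? zero    p0 = 0 , p0 , λ _ ()
least P? (suc k) pk with P? 0
... | yes p0 = 0 , p0 , λ _ ()
... | no ¬p0 with least (P? ∘ suc) k pk
...   | q , pq , below = suc q , pq , λ where
  zero    _         → ¬p0
  (suc j) (s≤s j<q) → below j j<q

module _ {A : Set} (τ : A → A) where

  orbit-periodic : ∀ {x p} → iterate τ x p ≡ x → Periodic p (iterate τ x)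
  orbit-periodic {x} {p} eq t =
    trans (cong (iterate τ x) (+-comm t p)) (trans (iterate-+ τ x p t) (cong (λ y → iterate τ y t) eq))

  orbit : A → ℕ → List⁺ A
  orbit x q = x ∷ applyUpTo (iterate τ x ∘ suc) q

  orbit-enumerates : Injective _≡_ _≡_ τ → ∀ {x q} → iterate τ x (suc q) ≡ x →
    (∀ k → k < q → iterate τ x (suc k) ≢ x) → Enumerates (orbit x q) (InOrbit τ x)
  orbit-enumerates inj {x} {q} period minimal =
    applyUpTo⁺₁ (iterate τ x) (suc q) distinct , λ y → mk⇔ sound (complete y)
    where
    distinct : ∀ {i j} → i < j → j < suc q → iterate τ x i ≢ iterate τ x j
    distinct {i} {j} i<j (s≤s j≤q) eq with j ∸ i | m∸n+n≡m (<⇒≤ i<j)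
    ... | zero  | refl = <-irrefl refl i<j
    -- Cancelling the first `i` iterates would give a return to `x` after `suc k` steps, before the
    -- minimal one.
    ... | suc k | refl = minimal k (<-≤-trans (s≤s (m≤m+n k i)) j≤q)
      (sym (iterate-injective inj i (trans eq (iterate-+ τ x (suc k) i))))

    sound : ∀ {y} → y ∈ applyUpTo (iterate τ x) (suc q) → InOrbit τ x y
    sound y∈ with ∈-applyUpTo⁻ (iterate τ x) y∈
    ... | k , _ , y≡ = k , sym y≡

    complete : ∀ y → InOrbit τ x y → y ∈ applyUpTo (iterate τ x) (suc q)
    complete _ (k , refl) = subst (_∈ applyUpTo (iterate τ x) (suc q)) (sym reduce)
      (∈-applyUpTo⁺ (iterate τ x) (m%n<n k (suc q)))
      where
      reduce : iterate τ x k ≡ iterate τ x (k % suc q)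
      reduce = trans (cong (iterate τ x) (m≡m%n+[m/n]*n k (suc q)))
        (periodic-multiple (orbit-periodic {x} {suc q} period) (k / suc q) (k % suc q))

-- Columns of a tuple

-- The default `d` is read past the end; taking it to be n + 1 supplies x_(n+1).
at : ∀ {n} → ℕ → Vec ℕ n → ℕ → ℕ
at d []      k       = d
at d (a ∷ x) zero    = a
at d (a ∷ x) (suc k) = at d x k

at-lookup : ∀ {n} d (x : Vec ℕ n) i → at d x (toℕ i) ≡ lookup x i
at-lookup d (a ∷ x) fzero    = refl
at-lookup d (a ∷ x) (fsuc i) = at-lookup d x i

at-next : ∀ {n} d (x : Vec ℕ n) i → at d x (suc (toℕ i)) ≡ lookup (x ∷ʳ d) (fsuc i)
at-next d (a ∷ [])    fzero    = refl
at-next d (a ∷ b ∷ x) fzero    = refl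
at-next d (a ∷ x)     (fsuc i) = at-next d x i

at-end : ∀ {n} d (x : Vec ℕ n) → at d x n ≡ d
at-end d []      = refl
at-end d (a ∷ x) = at-end d x

at-updated : ∀ {n} d (x : Vec ℕ n) i {v} → at d (x [ i ]≔ v) (toℕ i) ≡ v
at-updated d (a ∷ x) fzero    = refl
at-updated d (a ∷ x) (fsuc i) = at-updated d x i

at-untouched : ∀ {n} d (x : Vec ℕ n) i {v} k → toℕ i ≢ k → at d (x [ i ]≔ v) k ≡ at d x k
at-untouched d (a ∷ x) fzero    zero    i≢k = contradiction refl i≢k
at-untouched d (a ∷ x) fzero    (suc k) i≢k = refl
at-untouched d (a ∷ x) (fsuc i) zero    i≢k = refl
at-untouched d (a ∷ x) (fsuc i) (suc k) i≢k = at-untouched d x i k (i≢k ∘ cong suc)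

at-injective : ∀ {n} d (x x′ : Vec ℕ n) → (∀ k → k < n → at d x k ≡ at d x′ k) → x ≡ x′
at-injective d []      []        eq = refl
at-injective d (a ∷ x) (a′ ∷ x′) eq =
  cong₂ _∷_ (eq 0 (s≤s z≤n)) (at-injective d x x′ λ k k<n → eq (suc k) (s≤s k<n))

-- Columns 1, …, n are the coordinates x_1, …, x_n; column 0 is 0 and column n + 1 is n + 1.
col : ∀ {n} → S n → ℕ → ℕ
col         x zero    = 0
col {n = n} x (suc k) = at (suc n) (coords x) k

col-end : ∀ {n} (x : S n) → col x (suc n) ≡ suc n
col-end x = at-end _ (coords x)

col-injective : ∀ {n} {x x′ : S n} → (∀ k → k < n → col x (suc k) ≡ col x′ (suc k)) → x ≡ x′
col-injective {n} {mkS x _} {mkS x′ _} eq with at-injective (suc n) x x′ eq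
... | refl = refl

InS⇒◁ : ∀ {n} {x : Vec ℕ n} → InS x → ∀ k → k < n → at (suc n) x k ◁ at (suc n) x (suc k)
InS⇒◁ {n} {x} p k k<n 0<xk with fromℕ< k<n | toℕ-fromℕ< k<n
... | i | refl = subst (_< at (suc n) x (suc (toℕ i))) (sym (at-lookup _ x i)) (rise (m≤n⇒m<n∨m≡n k<n))
  where
  open InS p renaming (k to z)

  z≤i : z ≤ toℕ i
  z≤i = ≮⇒≥ λ i<z → <⇒≢ 0<xk (sym (trans (at-lookup _ x i) (zeros i i<z)))

  rise : suc (toℕ i) < n ⊎ suc (toℕ i) ≡ n → lookup x i < at (suc n) x (suc (toℕ i))
  rise (inj₁ i+1<n) with fromℕ< i+1<n | toℕ-fromℕ< i+1<n
  ... | j | j≡i+1 = subst (lookup x i <_) (trans (sym (at-lookup _ x j)) (cong (at (suc n) x) j≡i+1))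
    (increasing i j z≤i (≤-reflexive (sym j≡i+1)))
  rise (inj₂ i+1≡n) = subst (lookup x i <_) (sym (trans (cong (at (suc n) x) i+1≡n) (at-end _ x)))
    (s≤s (bounded-n i z≤i))

col-◁ : ∀ {n} (x : S n) i → i ≤ n → col x i ◁ col x (suc i)
col-◁ x           zero    _   ()
col-◁ {n} (mkS x p) (suc k) k<n 0<xk =
  -- The membership proof is irrelevant, but the inequality is decidable and can be recovered.
  recompute (at (suc n) x k <? at (suc n) x (suc k)) (InS⇒◁ p k k<n 0<xk)

reset-positive : ∀ {a} → 0 < a → reset a ≡ suc a
reset-positive {suc a} _ = refl

restart≡reset : ∀ {n} (x : S n) i → restart (coords x) i ≡ reset (col x (toℕ i))
restart≡reset x fzero = refl
restart≡reset {suc n} x (fsuc i)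
  rewrite trans (cong (at (suc (suc n)) (coords x)) (sym (toℕ-inject₁ i))) (at-lookup _ (coords x) (inject₁ i))
  with 0 <? lookup (coords x) (inject₁ i)
... | yes 0<a = sym (reset-positive 0<a)
... | no  0≮a = sym (cong reset (n≤0⇒n≡0 (≮⇒≥ 0≮a)))

winched≡winch : ∀ {n} (x : S n) i →
  winched (coords x) i ≡ winch (col x (toℕ i)) (col x (suc (toℕ i))) (col x (2 + toℕ i))
winched≡winch {n} x i
  rewrite at-lookup (suc n) (coords x) i | at-next (suc n) (coords x) i
  with suc (lookup (coords x) i) <? next (coords x) i
... | yes _ = refl
... | no  _ = restart≡reset x i

WZ-col : ∀ {n} (i : Fin n) x →
  col (WZ i x) (suc (toℕ i)) ≡ winch (col x (toℕ i)) (col x (suc (toℕ i))) (col x (2 + toℕ i))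
WZ-col i x = trans (at-updated _ (coords x) i) (winched≡winch x i)

WZ-col-other : ∀ {n} (i : Fin n) x {c} → suc (toℕ i) ≢ c → col (WZ i x) c ≡ col x c
WZ-col-other i x {zero}  _   = refl
WZ-col-other i x {suc k} i≢c = at-untouched _ (coords x) i k (i≢c ∘ cong suc)

-- Both neighbours of the winched coordinate are unchanged, so the two tuples share them and
-- `winch-injective` applies.
WZ-injective : ∀ {n} (i : Fin n) {x x′} → WZ i x ≡ WZ i x′ → x ≡ x′
WZ-injective {n} i {x} {x′} eq = col-injective same
  where
  other : ∀ {c} → suc (toℕ i) ≢ c → col x c ≡ col x′ c
  other {c} i≢c = trans (sym (WZ-col-other i x i≢c)) (trans (cong (λ z → col z c) eq) (WZ-col-other i x′ i≢c))

  same : ∀ k → k < n → col x (suc k) ≡ col x′ (suc k)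
  same k _ with toℕ i ≟ k
  ... | no  i≢k  = other (i≢k ∘ suc-injective)
  ... | yes refl = winch-injective (col-◁ x _ (<⇒≤ (toℕ<n i))) (col-◁ x _ (toℕ<n i))
    (subst (_◁ col x′ (suc k)) (sym left≡) (col-◁ x′ _ (<⇒≤ (toℕ<n i))))
    (subst (col x′ (suc k) ◁_) (sym right≡) (col-◁ x′ _ (toℕ<n i)))
    (begin
      winch (col x k) (col x (suc k)) (col x (2 + k))    ≡⟨ WZ-col i x ⟨
      col (WZ i x) (suc k)                               ≡⟨ cong (λ z → col z (suc k)) eq ⟩
      col (WZ i x′) (suc k)                              ≡⟨ WZ-col i x′ ⟩
      winch (col x′ k) (col x′ (suc k)) (col x′ (2 + k)) ≡⟨ cong₂ (λ a d → winch a (col x′ (suc k)) d) left≡ right≡ ⟨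
      winch (col x k) (col x′ (suc k)) (col x (2 + k))   ∎)
    where
    open ≡-Reasoning
    left≡ : col x k ≡ col x′ k
    left≡ = other 1+n≢n
    right≡ : col x (2 + k) ≡ col x′ (2 + k)
    right≡ = other (1+n≢n ∘ sym)

-- Winching along a list of indices

run : ∀ {n} → List (Fin n) → S n → S n
run l x = foldl (λ y i → WZ i y) x l

run-injective : ∀ {n} (l : List (Fin n)) {x x′} → run l x ≡ run l x′ → x ≡ x′
run-injective []      eq = eq
run-injective (i ∷ l) eq = WZ-injective i (run-injective l eq)

run-col-other : ∀ {n} {l : List (Fin n)} {c} → All (λ e → suc (toℕ e) ≢ c) l → ∀ x → col (run l x) c ≡ col x c
run-col-other []          x = refl
run-col-other (e≢c ∷ l≢c) x = trans (run-col-other l≢c _) (WZ-col-other _ x e≢c)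

-- Columns are numbered from 1, hence `suc (toℕ e)`. The boundary columns 0 and n + 1 are in no
-- list, so they never precede anything.
precedes : ∀ {n} → ℕ → ℕ → List (Fin n) → Bool
precedes d c []      = false
precedes d c (e ∷ l) with suc (toℕ e) ≟ d | suc (toℕ e) ≟ c
... | yes _ | _     = true
... | no  _ | yes _ = false
... | no  _ | no  _ = precedes d c l

precedes-asym : ∀ {n} {l : List (Fin n)} {i} d → i ∈ l → suc (toℕ i) ≢ d →
  precedes (suc (toℕ i)) d l ≡ not (precedes d (suc (toℕ i)) l)
precedes-asym {l = e ∷ l} {i} d i∈l i≢d with suc (toℕ e) ≟ d | suc (toℕ e) ≟ suc (toℕ i)
precedes-asym {l = e ∷ l} {i} d i∈l         i≢d | yes e≡d | yes e≡i = contradiction (trans (sym e≡i) e≡d) i≢d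
precedes-asym {l = e ∷ l} {i} d i∈l         i≢d | yes _   | no  _   = refl
precedes-asym {l = e ∷ l} {i} d i∈l         i≢d | no  _   | yes _   = refl
precedes-asym {l = e ∷ l} {i} d (here refl) i≢d | no  _   | no  e≢i = contradiction refl e≢i
precedes-asym {l = e ∷ l} {i} d (there i∈l) i≢d | no  _   | no  _   = precedes-asym d i∈l i≢d

-- The value in column `d` at the moment column `c` is winched. In a list without repetitions, a
-- column already winched keeps its value to the end of the run.
seenBy : ∀ {n} → List (Fin n) → S n → ℕ → ℕ → ℕ
seenBy l x c d = col (if precedes d c l then run l x else x) d

run-col : ∀ {n} {l : List (Fin n)} {i} → Unique l → i ∈ l → ∀ x → let c = suc (toℕ i) in
  col (run l x) c ≡ winch (seenBy l x c (toℕ i)) (col x c) (seenBy l x c (suc c))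
run-col {l = e ∷ l} {i} (e∉l ∷ l!) i∈l x with e Fin.≟ i
... | yes refl = begin
    col (run l (WZ i x)) c                                             ≡⟨ run-col-other (All.map i∉ e∉l) (WZ i x) ⟩
    col (WZ i x) c                                                     ≡⟨ WZ-col i x ⟩
    winch (col x (toℕ i)) (col x c) (col x (suc c))                    ≡⟨ cong₂ (λ a d → winch a (col x c) d) (first 1+n≢n) (first (1+n≢n ∘ sym)) ⟨
    winch (seenBy (i ∷ l) x c (toℕ i)) (col x c) (seenBy (i ∷ l) x c (suc c)) ∎
  where
  open ≡-Reasoning
  c = suc (toℕ i)
  i∉ : ∀ {e} → i ≢ e → suc (toℕ e) ≢ c
  i∉ i≢e e≡i = i≢e (sym (toℕ-injective (suc-injective e≡i)))
  first : ∀ {d} → c ≢ d → seenBy (i ∷ l) x c d ≡ col x d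
  first {d} c≢d with c ≟ d | c ≟ c
  ... | yes c≡d | _      = contradiction c≡d c≢d
  ... | no  _   | yes _  = refl
  ... | no  _   | no c≢c = contradiction refl c≢c
... | no e≢i = begin
    col (run l (WZ e x)) c                                                           ≡⟨ run-col l! (tail i∈l) (WZ e x) ⟩
    winch (seenBy l (WZ e x) c (toℕ i)) (col (WZ e x) c) (seenBy l (WZ e x) c (suc c)) ≡⟨ cong (λ b → winch (seenBy l (WZ e x) c (toℕ i)) b (seenBy l (WZ e x) c (suc c))) (WZ-col-other e x e≢c) ⟩
    winch (seenBy l (WZ e x) c (toℕ i)) (col x c) (seenBy l (WZ e x) c (suc c))        ≡⟨ cong₂ (λ a d → winch a (col x c) d) (later (toℕ i)) (later (suc c)) ⟩
    winch (seenBy (e ∷ l) x c (toℕ i)) (col x c) (seenBy (e ∷ l) x c (suc c))          ∎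
  where
  open ≡-Reasoning
  c = suc (toℕ i)
  e≢c : suc (toℕ e) ≢ c
  e≢c e≡c = e≢i (toℕ-injective (suc-injective e≡c))
  tail : i ∈ e ∷ l → i ∈ l
  tail (here i≡e)  = contradiction (sym i≡e) e≢i
  tail (there i∈l) = i∈l
  e∉ : ∀ {f} → e ≢ f → suc (toℕ f) ≢ suc (toℕ e)
  e∉ e≢f f≡e = e≢f (sym (toℕ-injective (suc-injective f≡e)))
  later : ∀ d → seenBy l (WZ e x) c d ≡ seenBy (e ∷ l) x c d
  later d with suc (toℕ e) ≟ d | suc (toℕ e) ≟ c
  ... | _        | yes e≡c = contradiction e≡c e≢c
  -- Column `d` has just been winched, and by uniqueness the rest of the list leaves it alone.
  ... | yes refl | no _    with precedes d c l
  ...   | true  = refl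
  ...   | false = sym (run-col-other (All.map e∉ e∉l) (WZ e x))
  later d | no e≢d | no _ with precedes d c l
  ...   | true  = refl
  ...   | false = WZ-col-other e x e≢d

-- Delaying the columns into a left-to-right evolution

bit : Bool → ℕ
bit false = 0
bit true  = 1

module Trajectory {n} (l : List (Fin n)) (l! : Unique l) (∈l : ∀ i → i ∈ l) {τ : S n → S n} (τ≗run : ∀ x → τ x ≡ run l x) (x : S n) where

  column : ℕ → ℕ → ℕ
  column i t = col (iterate τ x t) i

  -- A neighbour winched earlier in the same pass is seen at time `suc t`, any other at time `t`.
  column-winch : ∀ {i} t → i < n → column (suc i) (suc t) ≡
    winch (column i (bit (precedes i (suc i) l) + t)) (column (suc i) t) (column (2 + i) (bit (precedes (2 + i) (suc i) l) + t))
  column-winch t i<n with fromℕ< i<n | toℕ-fromℕ< i<n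
  ... | j | refl = begin
    column (suc (toℕ j)) (suc t)     ≡⟨ cong (λ z → col z (suc (toℕ j))) (trans (iterate-suc τ x t) (τ≗run z)) ⟩
    col (run l z) (suc (toℕ j))      ≡⟨ run-col l! (∈l j) z ⟩
    winch (seenBy l z (suc (toℕ j)) (toℕ j)) (col z (suc (toℕ j))) (seenBy l z (suc (toℕ j)) (2 + toℕ j))
      ≡⟨ cong₂ (λ a d → winch a (col z (suc (toℕ j))) d) (seen (toℕ j)) (seen (2 + toℕ j)) ⟩
    winch (column (toℕ j) (bit (precedes (toℕ j) (suc (toℕ j)) l) + t)) (col z (suc (toℕ j)))
      (column (2 + toℕ j) (bit (precedes (2 + toℕ j) (suc (toℕ j)) l) + t)) ∎
    where
    open ≡-Reasoning
    z = iterate τ x t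
    seen : ∀ d → seenBy l z (suc (toℕ j)) d ≡ column d (bit (precedes d (suc (toℕ j)) l) + t)
    seen d with precedes d (suc (toℕ j)) l
    ... | true  = cong (λ z → col z d) (sym (trans (iterate-suc τ x t) (τ≗run z)))
    ... | false = refl

  adjacent-order : ∀ {i} → i < n → precedes (suc i) i l ≡ not (precedes i (suc i) l)
  adjacent-order i<n with fromℕ< i<n | toℕ-fromℕ< i<n
  ... | j | refl = precedes-asym (toℕ j) (∈l j) 1+n≢n

  delay : ℕ → ℕ
  delay zero    = 0
  delay (suc i) = bit (precedes (suc i) i l) + delay i

  delay≤ : ∀ i → delay i ≤ i
  delay≤ zero    = z≤n
  delay≤ (suc i) with precedes (suc i) i l
  ... | true  = s≤s (delay≤ i)
  ... | false = m≤n⇒m≤1+n (delay≤ i)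

  delayed : ℕ → ℕ → ℕ
  delayed i t = column i (t + delay i)

  -- The delays absorb the order of winching: in delayed time the left neighbour is always seen
  -- after its update and the right one before it.
  delayed-evolution : Evolution n delayed
  delayed-evolution = record
    { left    = λ t → refl
    ; right   = λ t → col-end (iterate τ x (t + delay (suc n)))
    ; rises   = rises
    ; evolves = evolves
    }
    where
    rises-by-order : ∀ {i} u → i < n → column i u ◁ column (suc i) (bit (precedes (suc i) i l) + u)
    rises-by-order {i} u i<n with precedes (suc i) i l | precedes i (suc i) l | adjacent-order i<n | column-winch u i<n
    ... | false | _     | _    | _  = col-◁ (iterate τ x u) i (<⇒≤ i<n)
    -- Column `suc i` was winched while column `i` still held its old value, so `◁-winch` compares
    -- the two.
    ... | true  | false | refl | eq = subst (column i u ◁_) (sym eq)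
      (◁-winch (column (2 + i) (bit (precedes (2 + i) (suc i) l) + u)) (col-◁ (iterate τ x u) i (<⇒≤ i<n)))

    swap : ∀ a b c → a + (b + c) ≡ b + (a + c)
    swap = solve-∀

    rises : ∀ {i} t → i ≤ n → delayed i t ◁ delayed (suc i) t
    rises {i} t i≤n with m≤n⇒m<n∨m≡n i≤n
    ... | inj₁ i<n  = subst (λ u → delayed i t ◁ column (suc i) u) (swap (bit (precedes (suc i) i l)) t (delay i))
      (rises-by-order (t + delay i) i<n)
    ... | inj₂ refl = subst (delayed i t ◁_) (trans (col-end (iterate τ x (t + delay i))) (sym (col-end (iterate τ x (t + delay (suc i))))))
      (col-◁ (iterate τ x (t + delay i)) i ≤-refl)

    evolves : ∀ {i} t → i < n → delayed (suc i) (suc t) ≡ winch (delayed i (suc t)) (delayed (suc i) t) (delayed (2 + i) t)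
    evolves {i} t i<n = trans (column-winch (t + delay (suc i)) i<n)
      (cong₂ (λ u w → winch (column i u) (delayed (suc i) t) (column (2 + i) w))
        left-time (swap (bit (precedes (2 + i) (suc i) l)) t (delay (suc i))))
      where
      left-time : bit (precedes i (suc i) l) + (t + (bit (precedes (suc i) i l) + delay i)) ≡ suc (t + delay i)
      left-time rewrite adjacent-order i<n with precedes i (suc i) l
      ... | true  = refl
      ... | false = +-suc t (delay i)

-- Rational averages

fromℕ : ℕ → ℚ
fromℕ c = ℤ.+ c ℚ./ 1

-- `toℚᵘ` is injective, and the two sides are equivalent as unnormalised fractions.
fromℚᵘ-+ : ∀ p q → fromℚᵘ p ℚ.+ fromℚᵘ q ≡ fromℚᵘ (p ℚᵘ.+ q)
fromℚᵘ-+ p q = toℚᵘ-injective (ℚᵘ.≃-trans (toℚᵘ-homo-+ (fromℚᵘ p) (fromℚᵘ q))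
  (ℚᵘ.≃-trans (ℚᵘ.+-cong (toℚᵘ-fromℚᵘ p) (toℚᵘ-fromℚᵘ q)) (ℚᵘ.≃-sym (toℚᵘ-fromℚᵘ (p ℚᵘ.+ q)))))

fromℚᵘ-* : ∀ p q → fromℚᵘ p ℚ.* fromℚᵘ q ≡ fromℚᵘ (p ℚᵘ.* q)
fromℚᵘ-* p q = toℚᵘ-injective (ℚᵘ.≃-trans (toℚᵘ-homo-* (fromℚᵘ p) (fromℚᵘ q))
  (ℚᵘ.≃-trans (ℚᵘ.*-cong (toℚᵘ-fromℚᵘ p) (toℚᵘ-fromℚᵘ q)) (ℚᵘ.≃-sym (toℚᵘ-fromℚᵘ (p ℚᵘ.* q)))))

fromℕ-+ : ∀ a b → fromℕ (a + b) ≡ fromℕ a ℚ.+ fromℕ b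
fromℕ-+ a b = sym (trans (fromℚᵘ-+ (mkℚᵘ (ℤ.+ a) 0) (mkℚᵘ (ℤ.+ b) 0))
  (fromℚᵘ-cong sum≃))
  where
  sum≃ : mkℚᵘ (ℤ.+ a) 0 ℚᵘ.+ mkℚᵘ (ℤ.+ b) 0 ℚᵘ.≃ mkℚᵘ (ℤ.+ (a + b)) 0
  sum≃ = *≡* (cong (ℤ._* ℤ.+ 1) (cong₂ ℤ._+_ (ℤ.*-identityʳ (ℤ.+ a)) (ℤ.*-identityʳ (ℤ.+ b))))

1/p*p : ∀ q → (ℤ.+ 1 ℚ./ suc q) ℚ.* fromℕ (suc q) ≡ 1ℚ
1/p*p q = trans (fromℚᵘ-* (mkℚᵘ (ℤ.+ 1) q) (mkℚᵘ (ℤ.+ suc q) 0))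
  (fromℚᵘ-cong product≃)
  where
  product≃ : mkℚᵘ (ℤ.+ 1) q ℚᵘ.* mkℚᵘ (ℤ.+ suc q) 0 ℚᵘ.≃ ℚᵘ.1ℚᵘ
  product≃ = *≡* (trans (ℤ.*-identityʳ _) (cong (λ k → ℤ.+ 1 ℤ.* ℤ.+ k) (sym (*-identityʳ (suc q)))))

half-average : ∀ q c → c + c ≡ suc q → (ℤ.+ 1 ℚ./ suc q) ℚ.* fromℕ c ≡ ½
half-average q c c+c≡p = begin
  w ℚ.* fromℕ c                          ≡⟨ halve w (fromℕ c) ⟩
  ½ ℚ.* (w ℚ.* (fromℕ c ℚ.+ fromℕ c))    ≡⟨ cong (λ z → ½ ℚ.* (w ℚ.* z)) (trans (sym (fromℕ-+ c c)) (cong fromℕ c+c≡p)) ⟩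
  ½ ℚ.* (w ℚ.* fromℕ (suc q))            ≡⟨ cong (½ ℚ.*_) (1/p*p q) ⟩
  ½ ℚ.* 1ℚ                               ≡⟨⟩
  ½                                      ∎
  where
  open ≡-Reasoning
  w = ℤ.+ 1 ℚ./ suc q
  halve : ∀ w z → w ℚ.* z ≡ ½ ℚ.* (w ℚ.* (z ℚ.+ z))
  halve = solve 2 (λ w z → w :* z := con ½ :* (w :* (z :+ z))) refl
    where open +-*-Solver

module _ {A : Set} where

  sumℚ : List A → (A → ℚ) → ℚ
  sumℚ []      f = 0ℚ
  sumℚ (y ∷ l) f = f y ℚ.+ sumℚ l f

  seq-sumℝ : ∀ (l : List A) (f : A → ℝ) m → seq (sumℝ (map f l)) m ≡ sumℚ l (λ y → seq (f y) m)
  seq-sumℝ []      f m = refl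
  seq-sumℝ (y ∷ l) f m = cong (seq (f y) m ℚ.+_) (seq-sumℝ l f m)

  sumℚ-cong : ∀ l {f g : A → ℚ} → (∀ y → f y ≡ g y) → sumℚ l f ≡ sumℚ l g
  sumℚ-cong []      f≗g = refl
  sumℚ-cong (y ∷ l) f≗g = cong₂ ℚ._+_ (f≗g y) (sumℚ-cong l f≗g)

  sumℚ-* : ∀ c l (f : A → ℚ) → c ℚ.* sumℚ l f ≡ sumℚ l (λ y → c ℚ.* f y)
  sumℚ-* c []      f = ℚ.*-zeroʳ c
  sumℚ-* c (y ∷ l) f = trans (ℚ.*-distribˡ-+ c (f y) (sumℚ l f)) (cong (c ℚ.* f y ℚ.+_) (sumℚ-* c l f))

  sumℚ-+ : ∀ l (f g : A → ℚ) → sumℚ l (λ y → f y ℚ.+ g y) ≡ sumℚ l f ℚ.+ sumℚ l g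
  sumℚ-+ []      f g = refl
  sumℚ-+ (y ∷ l) f g = trans (cong (f y ℚ.+ g y ℚ.+_) (sumℚ-+ l f g)) (interchange (f y) (g y) (sumℚ l f) (sumℚ l g))
    where
    interchange : ∀ a b c d → (a ℚ.+ b) ℚ.+ (c ℚ.+ d) ≡ (a ℚ.+ c) ℚ.+ (b ℚ.+ d)
    interchange = solve 4 (λ a b c d → (a :+ b) :+ (c :+ d) := (a :+ c) :+ (b :+ d)) refl
      where open +-*-Solver

  sumℚ-zero : ∀ l → sumℚ l (λ (_ : A) → 0ℚ) ≡ 0ℚ
  sumℚ-zero []      = refl
  sumℚ-zero (y ∷ l) = trans (ℚ.+-identityˡ _) (sumℚ-zero l)

  sumℚ-applyUpTo : ∀ (s : ℕ → A) (f : A → ℚ) (g : A → ℕ) → (∀ y → f y ≡ fromℕ (g y)) → ∀ p →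
    sumℚ (applyUpTo s p) f ≡ fromℕ (∑ p (g ∘ s))
  sumℚ-applyUpTo s f g f≗g zero    = refl
  sumℚ-applyUpTo s f g f≗g (suc p) =
    trans (cong₂ ℚ._+_ (f≗g (s 0)) (sumℚ-applyUpTo (s ∘ suc) f g f≗g p)) (sym (fromℕ-+ (g (s 0)) _))

sumℚ-swap : ∀ {A B : Set} (l : List A) (l′ : List B) (f : A → B → ℚ) →
  sumℚ l (λ y → sumℚ l′ (f y)) ≡ sumℚ l′ (λ z → sumℚ l (λ y → f y z))
sumℚ-swap []      l′ f = sym (sumℚ-zero l′)
sumℚ-swap (y ∷ l) l′ f = trans (cong (sumℚ l′ (f y) ℚ.+_) (sumℚ-swap l l′ f))
  (sym (sumℚ-+ l′ (f y) λ z → sumℚ l (λ y → f y z)))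

-- Real sums and products are taken term by term, so at a fixed index `s` this is an interchange of
-- two finite rational sums.
weighted-combination : ∀ {A B : Set} (w q : ℚ) s (a : B → ℝ) (f : B → A → ℝ) (l : List A) (l′ : List B) →
  (∀ z → w ℚ.* sumℚ l (λ y → seq (f z y) s) ≡ q) →
  w ℚ.* seq (sumℝ (map (λ y → sumℝ (map (λ z → a z *ℝ f z y) l′)) l)) s ≡ seq (sumℝ (map (λ z → a z *ℝ fromℚ q) l′)) s
weighted-combination w q s a f l l′ avg = begin
  w ℚ.* seq (sumℝ (map (λ y → sumℝ (map (λ z → a z *ℝ f z y) l′)) l)) s
    ≡⟨ cong (w ℚ.*_) (seq-sumℝ l (λ y → sumℝ (map (λ z → a z *ℝ f z y) l′)) s) ⟩
  w ℚ.* sumℚ l (λ y → seq (sumℝ (map (λ z → a z *ℝ f z y) l′)) s)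
    ≡⟨ cong (w ℚ.*_) (sumℚ-cong l λ y → seq-sumℝ l′ (λ z → a z *ℝ f z y) s) ⟩
  w ℚ.* sumℚ l (λ y → sumℚ l′ (λ z → seq (a z) s ℚ.* seq (f z y) s))
    ≡⟨ cong (w ℚ.*_) (sumℚ-swap l l′ λ y z → seq (a z) s ℚ.* seq (f z y) s) ⟩
  w ℚ.* sumℚ l′ (λ z → sumℚ l (λ y → seq (a z) s ℚ.* seq (f z y) s))
    ≡⟨ sumℚ-* w l′ (λ z → sumℚ l (λ y → seq (a z) s ℚ.* seq (f z y) s)) ⟩
  sumℚ l′ (λ z → w ℚ.* sumℚ l (λ y → seq (a z) s ℚ.* seq (f z y) s))
    ≡⟨ sumℚ-cong l′ term ⟩
  sumℚ l′ (λ z → seq (a z) s ℚ.* q)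
    ≡⟨ seq-sumℝ l′ (λ z → a z *ℝ fromℚ q) s ⟨
  seq (sumℝ (map (λ z → a z *ℝ fromℚ q) l′)) s ∎
  where
  open ≡-Reasoning

  swapˡ : ∀ u v z → u ℚ.* (v ℚ.* z) ≡ v ℚ.* (u ℚ.* z)
  swapˡ = solve 3 (λ u v z → u :* (v :* z) := v :* (u :* z)) refl
    where open +-*-Solver

  term : ∀ z → w ℚ.* sumℚ l (λ y → seq (a z) s ℚ.* seq (f z y) s) ≡ seq (a z) s ℚ.* q
  term z = trans (cong (w ℚ.*_) (sym (sumℚ-* (seq (a z) s) l (λ y → seq (f z y) s))))
    (trans (swapˡ w (seq (a z) s) (sumℚ l (λ y → seq (f z y) s))) (cong (seq (a z) s ℚ.*_) (avg z)))

pointwise⇒≃ : ∀ {x y} → (∀ m → seq x m ≡ seq y m) → x ≃ y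
pointwise⇒≃ {x} {y} eq ε 0<ε = 0 , λ m _ →
  subst (ℚ._< ε) (cong ∣_∣ (sym (trans (cong (ℚ._- seq y m) (eq m)) (ℚ.+-inverseʳ (seq y m))))) 0<ε

-- Counting the occurrences of a value in a tuple

occurrencesOf : ∀ {n} → ℕ → S n → ℕ
occurrencesOf {n} j x = ∑ n (λ k → δ (col x (suc k)) j)

∑-δ-absent : ∀ {n} d j (x : Vec ℕ n) → ¬ (j Vec.∈ x) → ∑ n (λ k → δ (at d x k) j) ≡ 0
∑-δ-absent d j []      j∉x = refl
∑-δ-absent d j (a ∷ x) j∉x =
  cong₂ _+_ (δ-≢ (j∉x ∘ Any.here ∘ sym)) (∑-δ-absent d j x (j∉x ∘ Any.there))

∈⇒at : ∀ {n} d {j} {x : Vec ℕ n} → j Vec.∈ x → ∃[ k ] k < n × at d x k ≡ j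
∈⇒at d (Any.here refl) = 0 , s≤s z≤n , refl
∈⇒at d (Any.there j∈x) with ∈⇒at d j∈x
... | k , k<n , eq = suc k , s≤s k<n , eq

◁-chain : ∀ (g : ℕ → ℕ) k → (∀ i → i ≤ k → g i ◁ g (suc i)) → g 0 ◁ g (suc k)
◁-chain g zero    rises 0<g₀ = rises 0 z≤n 0<g₀
◁-chain g (suc k) rises 0<g₀ = <-trans g₀<gₖ (rises (suc k) ≤-refl (<-trans 0<g₀ g₀<gₖ))
  where
  g₀<gₖ : g 0 < g (suc k)
  g₀<gₖ = ◁-chain g k (λ i i≤k → rises i (m≤n⇒m≤1+n i≤k)) 0<g₀

-- Everything after a positive entry is larger by `◁-chain`, and an equal earlier entry would be
-- positive, hence smaller.
∑-δ-present : ∀ n (g : ℕ → ℕ) → (∀ i → i < n → g i ◁ g (suc i)) → ∀ k → k < n → 0 < g k → ∑ n (λ i → δ (g i) (g k)) ≡ 1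
∑-δ-present (suc n) g rises zero    _         0<gk = cong₂ _+_ (δ-refl (g 0))
  (∑-zero n λ i i<n → δ-≢ (≢-sym (<⇒≢ (◁-chain g i (λ h h≤i → rises h (m≤n⇒m≤1+n (≤-<-trans h≤i i<n))) 0<gk))))
∑-δ-present (suc n) g rises (suc k) (s≤s k<n) 0<gk = cong₂ _+_ (δ-≢ g₀≢gk)
  (∑-δ-present n (g ∘ suc) (λ i i<n → rises (suc i) (s≤s i<n)) k k<n 0<gk)
  where
  g₀≢gk : g 0 ≢ g (suc k)
  g₀≢gk eq = <⇒≢ (◁-chain g k (λ h h≤k → rises h (m≤n⇒m≤1+n (≤-<-trans h≤k k<n))) (subst (0 <_) (sym eq) 0<gk)) eq

-- Positive values do not repeat in a tuple, so the indicator becomes a count, which can be split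
-- over columns.
seq-indicator : ∀ {n j} → 1 ≤ j → ∀ m (x : S n) → seq (indicator j x) m ≡ fromℕ (occurrencesOf j x)
seq-indicator {n} {j} 1≤j m x with j ∈? coords x
... | no  j∉x = cong fromℕ (sym (∑-δ-absent _ j (coords x) j∉x))
... | yes j∈x with ∈⇒at (suc n) j∈x
...   | k , k<n , refl = cong fromℕ (sym (∑-δ-present n (col x ∘ suc) (λ i i<n → col-◁ x (suc i) i<n) k k<n 1≤j))

S-≟ : ∀ {n} → DecidableEquality (S n)
S-≟ (mkS x p) (mkS x′ p′) = map′ (λ where refl → refl) (cong coords) (≡-dec _≟_ x x′)

-- One list serves all `j` at once, so a linear combination can be averaged over the same
-- enumeration.
HalfAverages : ∀ {n} → List⁺ (S n) → Set
HalfAverages {n} L = ∀ j → 1 ≤ j → j ≤ n → ∀ s →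
  (ℤ.+ 1 ℚ./ List⁺.length L) ℚ.* sumℚ (List⁺.toList L) (λ y → seq (indicator j y) s) ≡ ½

indicator-average : ∀ {n} (L : List⁺ (S n)) {j} → 1 ≤ j → j ≤ n → HalfAverages L → average (indicator j) L ≃ fromℚ ½
indicator-average L {j} 1≤j j≤n half = pointwise⇒≃ {average (indicator j) L} {fromℚ ½} λ s →
  trans (cong ((ℤ.+ 1 ℚ./ List⁺.length L) ℚ.*_) (seq-sumℝ (List⁺.toList L) (indicator j) s)) (half j 1≤j j≤n s)

halfSum : ∀ {n} → (Fin n → ℝ) → ℝ
halfSum {n} a = sumℝ (map (λ j → a j *ℝ fromℚ ½) (allFin n))

linearCombination-average : ∀ {n} (a : Fin n → ℝ) (L : List⁺ (S n)) → HalfAverages L →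
  average (linearCombination a) L ≃ halfSum a
linearCombination-average {n} a L half = pointwise⇒≃ {average (linearCombination a) L} {halfSum a} λ s →
  weighted-combination (ℤ.+ 1 ℚ./ List⁺.length L) ½ s a (λ j → indicator (suc (toℕ j)))
    (List⁺.toList L) (allFin n) (λ j → half (suc (toℕ j)) (s≤s z≤n) (toℕ<n j) s)

-- Period and homomesy for one pass through all indices in any order

+-swapʳ : ∀ a b c → a + b + c ≡ a + c + b
+-swapʳ = solve-∀

module Passes {m} (l : List (Fin (suc m))) (l! : Unique l) (∈l : ∀ i → i ∈ l)
         {τ : S (suc m) → S (suc m)} (τ≗run : ∀ x → τ x ≡ run l x) where
  private
    n = suc m

  pass-injective : Injective _≡_ _≡_ τ
  pass-injective {x} {x′} eq = run-injective l (trans (sym (τ≗run x)) (trans eq (τ≗run x′)))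

  -- Times 2n and 4n are compared: subtracting a delay of at most n from 2n leaves a time late
  -- enough for `evolution-periodic`. Injectivity then cancels 2n iterates.
  pass-period : ∀ x → iterate τ x (n + n) ≡ x
  pass-period x = iterate-injective pass-injective (n + n) (trans (sym (iterate-+ τ x (n + n) (n + n))) (col-injective columns))
    where
    open Trajectory l l! ∈l τ≗run x

    columns : ∀ k → k < n → col (iterate τ x (n + n + (n + n))) (suc k) ≡ col (iterate τ x (n + n)) (suc k)
    columns k (s≤s k≤m) = begin
      column (suc k) (n + n + (n + n))     ≡⟨ cong (column (suc k)) (trans (cong (_+ (n + n)) (sym t+d≡)) (+-swapʳ t d (n + n))) ⟩
      column (suc k) (t + (n + n) + d)     ≡⟨ evolution-periodic delayed-evolution k≤m n≤t ⟩
      column (suc k) (t + d)               ≡⟨ cong (column (suc k)) t+d≡ ⟩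
      column (suc k) (n + n)               ∎
      where
      open ≡-Reasoning
      d t : ℕ
      d = delay (suc k)
      t = n + n ∸ d
      d≤n : d ≤ n
      d≤n = ≤-trans (delay≤ (suc k)) (s≤s k≤m)
      t+d≡ : t + d ≡ n + n
      t+d≡ = m∸n+n≡m (≤-trans d≤n (m≤m+n n n))
      n≤t : n ≤ t
      n≤t = subst (n ≤_) (sym (+-∸-assoc n d≤n)) (m≤m+n n (n ∸ d))

  pass-bijective : Bijective _≡_ _≡_ τ
  -- `m + n` is 2n - 1, so this iterate is a preimage of `y`.
  pass-bijective = pass-injective , λ y → iterate τ y (m + n) ,
    λ where refl → trans (sym (iterate-suc τ y (m + n))) (pass-period y)

  -- A delay only shifts a column in time, which does not change its sum over a full period.
  pass-occurrences : ∀ {x p j} → iterate τ x p ≡ x → 1 ≤ j → j ≤ n →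
    let c = ∑ p (occurrencesOf j ∘ iterate τ x) in c + c ≡ p
  pass-occurrences {x} {p} {j} period 1≤j j≤n =
    subst (λ c → c + c ≡ p) undelay (occurrences delayed-evolution delayed-periodic 1≤j j≤n)
    where
    open Trajectory l l! ∈l τ≗run x

    column-periodic : ∀ i → Periodic p (column i)
    column-periodic i t = cong (λ z → col z i) (orbit-periodic τ period t)

    delayed-periodic : ∀ {i} → i ≤ n → Periodic p (delayed i)
    delayed-periodic {i} _ t = trans (cong (column i) (+-swapʳ t p (delay i))) (column-periodic i (t + delay i))

    undelay : ∑ p (λ t → ∑ n (λ k → δ (delayed (suc k) t) j)) ≡ ∑ p (occurrencesOf j ∘ iterate τ x)
    undelay = begin
      ∑ p (λ t → ∑ n (λ k → δ (delayed (suc k) t) j))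
        ≡⟨ ∑-swap p n (λ t k → δ (delayed (suc k) t) j) ⟩
      ∑ n (λ k → ∑ p (λ t → δ (delayed (suc k) t) j))
        ≡⟨ ∑-cong n (λ k _ → ∑-shift (λ t → cong (λ b → δ b j) (column-periodic (suc k) t)) (delay (suc k))) ⟩
      ∑ n (λ k → ∑ p (λ t → δ (column (suc k) t) j))
        ≡⟨ ∑-swap n p (λ k t → δ (column (suc k) t) j) ⟩
      ∑ p (occurrencesOf j ∘ iterate τ x) ∎
      where open ≡-Reasoning

  half-orbit : ∀ x → ∃[ L ] Enumerates L (InOrbit τ x) × HalfAverages L
  -- The period sought is `suc k`, hence positive; `m + n` bounds the search because `n + n` is
  -- `suc (m + n)`.
  half-orbit x with least (λ k → S-≟ (iterate τ x (suc k)) x) (m + n) (pass-period x)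
  ... | q , period , minimal = orbit τ x q , orbit-enumerates τ pass-injective period minimal , average-½
    where
    average-½ : HalfAverages (orbit τ x q)
    average-½ j 1≤j j≤n s = begin
      (ℤ.+ 1 ℚ./ suc (List.length (applyUpTo (iterate τ x ∘ suc) q))) ℚ.* total
        ≡⟨ cong (λ k → (ℤ.+ 1 ℚ./ suc k) ℚ.* total) (length-applyUpTo (iterate τ x ∘ suc) q) ⟩
      (ℤ.+ 1 ℚ./ suc q) ℚ.* total
        ≡⟨ cong ((ℤ.+ 1 ℚ./ suc q) ℚ.*_)
             (sumℚ-applyUpTo (iterate τ x) (λ y → seq (indicator j y) s) (occurrencesOf j) (seq-indicator 1≤j s) (suc q)) ⟩
      (ℤ.+ 1 ℚ./ suc q) ℚ.* fromℕ (∑ (suc q) (occurrencesOf j ∘ iterate τ x))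
        ≡⟨ half-average q (∑ (suc q) (occurrencesOf j ∘ iterate τ x)) (pass-occurrences {x} {suc q} period 1≤j j≤n) ⟩
      ½ ∎
      where
      open ≡-Reasoning
      total : ℚ
      total = sumℚ (applyUpTo (iterate τ x) (suc q)) (λ y → seq (indicator j y) s)

  indicator-homomesic : ∀ {j} → 1 ≤ j → j ≤ n → HomomesicWithAverage τ (indicator j) (fromℚ ½)
  indicator-homomesic 1≤j j≤n =
    pass-bijective , λ x → map₂ (λ {L} → map₂ (indicator-average L 1≤j j≤n)) (half-orbit x)

  linearCombination-homomesic : (a : Fin n → ℝ) → Homomesic τ (linearCombination a)
  linearCombination-homomesic a =
    halfSum a , pass-bijective , λ x → map₂ (λ {L} → map₂ (linearCombination-average a L)) (half-orbit x)

-- The order of winching given by a permutation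

order : ∀ {n} → Permutation′ n → List (Fin n)
order {n} ν = map (ν ⟨$⟩ʳ_) (allFin n)

order-unique : ∀ {n} (ν : Permutation′ n) → Unique (order ν)
order-unique {n} ν = unique-map⁺ (λ eq → trans (sym (inverseˡ ν)) (trans (cong (ν ⟨$⟩ˡ_) eq) (inverseˡ ν))) (allFin⁺ n)

∈-order : ∀ {n} (ν : Permutation′ n) i → i ∈ order ν
∈-order ν i = subst (_∈ order ν) (inverseʳ ν) (∈-map⁺ (ν ⟨$⟩ʳ_) (∈-allFin (ν ⟨$⟩ˡ i)))

WZ-perm≗run : ∀ {n} (ν : Permutation′ n) x → WZ-perm ν x ≡ run (order ν) x
WZ-perm≗run {n} ν x = sym (foldl-map (λ y i → WZ i y) (ν ⟨$⟩ʳ_) x (allFin n))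

mainTheorem9 : ∀ (n : ℕ) → 1 ≤ n → (ν : Permutation′ n) →
    (∀ (x : S n) → iterate (WZ-perm ν) x (2 * n) ≡ x)
    × (∀ (j : ℕ) → 1 ≤ j → j ≤ n → HomomesicWithAverage (WZ-perm ν) (indicator j) (fromℚ ½))
    × (∀ (a : Fin n → ℝ) → Homomesic (WZ-perm ν) (linearCombination a))
mainTheorem9 n@(suc _) _ ν =
    (λ x → trans (cong (λ k → iterate (WZ-perm ν) x (n + k)) (+-identityʳ n)) (pass-period x))
  , (λ _ → indicator-homomesic)
  , linearCombination-homomesic
  where open Passes (order ν) (order-unique ν) (∈-order ν) (WZ-perm≗run ν)
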